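{- If $\tau \in \{0010,0100,0110,0123\}$, then $$f_\tau(x)=\frac{(1-x)(1-4x+4x^2+x^3)}{(1-2x)^3}$$ as formal power series in $x$, where $f_\tau(x)=\sum_{n\ge 0} b_n(\tau)x^n$ and $b_n(\tau)$ is the number of ascent sequences of length $n$ that avoid both patterns $021$ and $\tau$.
   Context: For a finite sequence $w=w_1\cdots w_n$ of integers, $\mathrm{asc}(w)$ is the number of indices $1\le i\le n-1$ with $w_i<w_{i+1}$. An ascent sequence of length $n\ge 1$ is a sequence $a_1\cdots a_n$ of non-negative integers such that $a_1=0$ and $a_i\le \mathrm{asc}(a_1\cdots a_{i-1})+1$ for $1<i\le n$; there is exactly one (empty) ascent sequence of length $0$. A sequence $\pi=\pi_1\cdots\pi_n$ contains a pattern $\tau=\tau_1\cdots\tau_m$ if there are indices $1\le i_1<\cdots<i_m\le n$ such that for all $j,k\in\{1,\dots,m\}$: $\pi_{i_j}<\pi_{i_k}$ iff $\tau_j<\tau_k$, and $\pi_{i_j}=\pi_{i_k}$ iff $\tau_j=\tau_k$; otherwise $\pi$ avoids $\tau$. For a pattern $\tau$, $B_n(\tau)$ is the set of ascent sequences of length $n$ avoiding both $021$ and $\tau$ (with $B_0(\tau)$ consisting of the empty sequence), and $b_n(\tau)=|B_n(\tau)|$. -}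

module Defs where

open import Data.Bool.Base using (true; false; if_then_else_)
open import Data.Fin.Base as Fin using (Fin; zero; suc; toℕ; finToFun; funToFin)
import Data.Fin.Properties as Fin
open import Data.Integer.Base as ℤ using (ℤ; +_; 0ℤ; 1ℤ)
import Data.Integer.Properties as ℤ
open import Data.Integer.Solver using (module +-*-Solver)
open import Data.List.Base
  using (List; []; _∷_; length; lookup; take; filter; upTo; cartesianProductWith)
import Data.List.Properties as List
open import Data.List.Membership.Propositional using (_∈_)
import Data.List.Membership.Propositional.Properties as ∈
open import Data.List.Relation.Unary.All using (All; []; _∷_)
open import Data.List.Relation.Unary.Any using (here)
open import Data.List.Relation.Unary.AllPairs using ([]; _∷_)
open import Data.List.Relation.Unary.Unique.Propositional using (Unique)
import Data.List.Relation.Unary.Unique.Propositional.Properties as Unique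
open import Data.Nat.Base as ℕ using (ℕ; zero; suc; _∸_; _≤_; _<_; z≤n; s≤s; z<s)
import Data.Nat.Properties as ℕ
open import Data.Product.Base using (∃-syntax; _×_; _,_; proj₂)
open import Function.Base using (_∘_)
open import Function.Bundles using (_⇔_; mk⇔; Equivalence)
open import Relation.Binary.Core using (_Preserves_⟶_)
open import Relation.Binary.PropositionalEquality
  using (_≡_; _≗_; refl; sym; cong; subst; subst₂; module ≡-Reasoning)
open import Relation.Nullary.Decidable
  using (Dec; does; map′; _×-dec_; _→-dec_; ¬?)
open import Relation.Nullary.Negation using (¬_)

open import Algebra.Properties.CommutativeMonoid.Sum ℤ.+-0-commutativeMonoid
  using (sum-syntax)

asc : List ℕ → ℕ
asc []          = 0
asc (_ ∷ [])    = 0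
asc (x ∷ y ∷ w) = (if does (x ℕ.<? y) then 1 else 0) ℕ.+ asc (y ∷ w)

-- Positions are counted from 0, so `take (toℕ i) w` is the part of w
-- strictly before position i.
record IsAscentSequence (w : List ℕ) : Set where
  field
    starts  : ∀ (i : Fin (length w)) → toℕ i ≡ 0 → lookup w i ≡ 0
    bounded : ∀ (i : Fin (length w)) → 0 < toℕ i →
              lookup w i ≤ asc (take (toℕ i) w) ℕ.+ 1

record IsOccurrence (π τ : List ℕ) (ι : Fin (length τ) → Fin (length π)) : Set where
  field
    increasing : ι Preserves Fin._<_ ⟶ Fin._<_
    order      : ∀ j k → lookup π (ι j) < lookup π (ι k) ⇔ lookup τ j < lookup τ k
    equality   : ∀ j k → lookup π (ι j) ≡ lookup π (ι k) ⇔ lookup τ j ≡ lookup τ k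

Contains : List ℕ → List ℕ → Set
Contains π τ = ∃[ ι ] IsOccurrence π τ ι

Avoids : List ℕ → List ℕ → Set
Avoids π τ = ¬ Contains π τ

record B (τ : List ℕ) (n : ℕ) (w : List ℕ) : Set where
  field
    hasLength  : length w ≡ n
    isAscent   : IsAscentSequence w
    avoids-021 : Avoids w (0 ∷ 2 ∷ 1 ∷ [])
    avoids-τ   : Avoids w τ

isAscentSequence? : ∀ w → Dec (IsAscentSequence w)
isAscentSequence? w =
  map′ (λ (s , b) → record { starts = s ; bounded = b })
       (λ a → let open IsAscentSequence a in starts , bounded)
       (Fin.all? (λ i → (toℕ i ℕ.≟ 0) →-dec (lookup w i ℕ.≟ 0))
        ×-dec
        Fin.all? (λ i → (0 ℕ.<? toℕ i) →-dec
                        (lookup w i ℕ.≤? asc (take (toℕ i) w) ℕ.+ 1)))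

private
  _⇔-dec_ : ∀ {P Q : Set} → Dec P → Dec Q → Dec (P ⇔ Q)
  p? ⇔-dec q? = map′ (λ (f , g) → mk⇔ f g)
                     (λ e → Equivalence.to e , Equivalence.from e)
                     ((p? →-dec q?) ×-dec (q? →-dec p?))

isOccurrence? : ∀ π τ ι → Dec (IsOccurrence π τ ι)
isOccurrence? π τ ι =
  map′ (λ (i , o , e) → record { increasing = λ {j} {k} → i j k ; order = o ; equality = e })
       (λ a → let open IsOccurrence a in (λ _ _ → increasing) , order , equality)
       (Fin.all? (λ j → Fin.all? λ k → (j Fin.<? k) →-dec (ι j Fin.<? ι k))
        ×-dec
        Fin.all? (λ j → Fin.all? λ k →
          (lookup π (ι j) ℕ.<? lookup π (ι k)) ⇔-dec (lookup τ j ℕ.<? lookup τ k))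
        ×-dec
        Fin.all? (λ j → Fin.all? λ k →
          (lookup π (ι j) ℕ.≟ lookup π (ι k)) ⇔-dec (lookup τ j ℕ.≟ lookup τ k)))

isOccurrence-resp-≗ : ∀ {π τ ι κ} → ι ≗ κ → IsOccurrence π τ ι → IsOccurrence π τ κ
isOccurrence-resp-≗ {π} {τ} eq a = record
  { increasing = λ {j} {k} j<k → subst₂ Fin._<_ (eq j) (eq k) (increasing j<k)
  ; order      = λ j k → subst₂ (λ p q → lookup π p < lookup π q ⇔ lookup τ j < lookup τ k)
                                (eq j) (eq k) (order j k)
  ; equality   = λ j k → subst₂ (λ p q → lookup π p ≡ lookup π q ⇔ lookup τ j ≡ lookup τ k)
                                (eq j) (eq k) (equality j k)
  } where open IsOccurrence a

contains? : ∀ π τ → Dec (Contains π τ)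
contains? π τ =
  map′ (λ (c , occ) → finToFun c , occ)
       (λ (ι , occ) → funToFin ι ,
                      isOccurrence-resp-≗ (sym ∘ Fin.finToFun-funToFin ι) occ)
       (Fin.any? (λ c → isOccurrence? π τ (finToFun c)))

B? : ∀ τ n w → Dec (B τ n w)
B? τ n w =
  map′ (λ (l , a , p , q) → record
         { hasLength = l ; isAscent = a ; avoids-021 = p ; avoids-τ = q })
       (λ x → let open B x in hasLength , isAscent , avoids-021 , avoids-τ)
       ((length w ℕ.≟ n) ×-dec isAscentSequence? w
        ×-dec ¬? (contains? w (0 ∷ 2 ∷ 1 ∷ [])) ×-dec ¬? (contains? w τ))

-- All words of length n over {0, …, k − 1}.
words : ℕ → ℕ → List (List ℕ)
words k zero    = [] ∷ []
words k (suc n) = cartesianProductWith _∷_ (upTo k) (words k n)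

-- The entries of an ascent sequence of length n are smaller than n, so nothing
-- is lost by filtering `words n n`; see `∈-enumerate` and `enumerate-unique`.
enumerate : List ℕ → ℕ → List (List ℕ)
enumerate τ n = filter (B? τ n) (words n n)

b : List ℕ → ℕ → ℕ
b τ n = length (enumerate τ n)

words-unique : ∀ k n → Unique (words k n)
words-unique k zero    = [] ∷ []
words-unique k (suc n) =
  Unique.cartesianProductWith⁺ _∷_ List.∷-injective (Unique.upTo⁺ k) (words-unique k n)

∈-words : ∀ {k} w → All (_< k) w → w ∈ words k (length w)
∈-words []      []       = here refl
∈-words (x ∷ w) (p ∷ ps) =
  ∈.∈-cartesianProductWith⁺ _∷_ (∈.∈-upTo⁺ p) (∈-words w ps)

asc≤ : ∀ x w → asc (x ∷ w) ≤ length w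
asc≤ x []      = z≤n
asc≤ x (y ∷ w) with does (x ℕ.<? y)
... | true  = s≤s (asc≤ y w)
... | false = ℕ.m≤n⇒m≤1+n (asc≤ y w)

ascent-entry< : ∀ w → IsAscentSequence w → ∀ i → lookup w i < length w
ascent-entry< (x ∷ w) a zero    = subst (_< suc (length w)) (sym (starts zero refl)) z<s
  where open IsAscentSequence a
ascent-entry< (x ∷ w) a (suc i) = s≤s (begin
  lookup w i                          ≤⟨ bounded (suc i) z<s ⟩
  asc (x ∷ take (toℕ i) w) ℕ.+ 1      ≡⟨ ℕ.+-comm _ 1 ⟩
  suc (asc (x ∷ take (toℕ i) w))      ≤⟨ s≤s (asc≤ x (take (toℕ i) w)) ⟩
  suc (length (take (toℕ i) w))       ≡⟨ cong suc (List.length-take (toℕ i) w) ⟩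
  suc (toℕ i ℕ.⊓ length w)            ≤⟨ s≤s (ℕ.m⊓n≤m (toℕ i) (length w)) ⟩
  suc (toℕ i)                         ≤⟨ Fin.toℕ<n i ⟩
  length w                            ∎)
  where open IsAscentSequence a
        open ℕ.≤-Reasoning

enumerate-unique : ∀ τ n → Unique (enumerate τ n)
enumerate-unique τ n = Unique.filter⁺ (B? τ n) (words-unique n n)

∈-enumerate : ∀ τ n w → w ∈ enumerate τ n ⇔ B τ n w
∈-enumerate τ n w = mk⇔ to from
  where
  all< : ∀ v {k} → (∀ i → lookup v i < k) → All (_< k) v
  all< []      h = []
  all< (_ ∷ v) h = h zero ∷ all< v (h ∘ suc)

  candidate : B τ n w → w ∈ words n n
  candidate record { hasLength = refl ; isAscent = a } =
    ∈-words w (all< w (ascent-entry< w a))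

  from : B τ n w → w ∈ enumerate τ n
  from x = ∈.∈-filter⁺ (B? τ n) (candidate x) x

  to : w ∈ enumerate τ n → B τ n w
  to w∈ = proj₂ (∈.∈-filter⁻ (B? τ n) {xs = words n n} w∈)

Series : Set
Series = ℕ → ℤ

infix  4 _≈_
infixl 6 _+_ _-_
infixl 7 _*_ _/_⟨_⟩
infixr 7 _·_
infixr 8 _^_

_≈_ : Series → Series → Set
f ≈ g = ∀ n → f n ≡ g n

1# : Series
1# zero    = 1ℤ
1# (suc _) = 0ℤ

X : Series
X zero    = 0ℤ
X (suc n) = 1# n

_+_ _-_ _*_ : Series → Series → Series
(f + g) n = f n ℤ.+ g n
(f - g) n = f n ℤ.- g n
(f * g) n = ∑[ i < suc n ] (f (toℕ i) ℤ.* g (n ∸ toℕ i))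

_·_ : ℕ → Series → Series
(c · f) n = + c ℤ.* f n

_^_ : Series → ℕ → Series
f ^ zero  = 1#
f ^ suc k = f * f ^ k

-- The quotient by a series with constant term 1, by long division:
-- if q g = f then q₀ = f₀, and the shifted series (q − q₀)/X is the
-- quotient of (f − f₀ g)/X by g.
_/_⟨_⟩ : Series → (g : Series) → g 0 ≡ 1ℤ → Series
(f / g ⟨ g₀ ⟩) zero    = f 0
(f / g ⟨ g₀ ⟩) (suc n) = ((λ m → f (suc m) ℤ.- f 0 ℤ.* g (suc m)) / g ⟨ g₀ ⟩) n

/-*-cancel : ∀ f g (g₀ : g 0 ≡ 1ℤ) → (f / g ⟨ g₀ ⟩) * g ≈ f
/-*-cancel f g g₀ zero = begin
  f 0 ℤ.* g 0 ℤ.+ 0ℤ  ≡⟨ ℤ.+-identityʳ _ ⟩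
  f 0 ℤ.* g 0         ≡⟨ cong (f 0 ℤ.*_) g₀ ⟩
  f 0 ℤ.* 1ℤ          ≡⟨ ℤ.*-identityʳ _ ⟩
  f 0                 ∎
  where open ≡-Reasoning
/-*-cancel f g g₀ (suc n) = begin
  c ℤ.+ ((f′ / g ⟨ g₀ ⟩) * g) n  ≡⟨ cong (λ z → c ℤ.+ z) (/-*-cancel f′ g g₀ n) ⟩
  c ℤ.+ (f (suc n) ℤ.- c)        ≡⟨ solve 2 (λ x y → x :+ (y :- x) := y) refl c (f (suc n)) ⟩
  f (suc n)                      ∎
  where
  open ≡-Reasoning
  open +-*-Solver
  c  = f 0 ℤ.* g (suc n)
  f′ : Series
  f′ m = f (suc m) ℤ.- f 0 ℤ.* g (suc m)

generatingFunction : List ℕ → Series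
generatingFunction τ n = + b τ n

{-# OPTIONS --safe #-}
-- A word 0v avoids 021 iff the nonzero entries of v weakly increase, and each of the four
-- patterns then reduces to a condition on v alone: no subword x < y < z of nonzero entries for
-- 0123, and no subword xx0, x00 or 0x0 with x > 0 for 0110, 0100 and 0010.  Reading v from left
-- to right, what may follow depends only on the number of ascents, the largest entry, whether
-- the last entry is 0, and how much of the forbidden subword has been seen.  In the resulting
-- automata all runs have counts of the form (polynomial in n) 2ⁿ; those from the start states
-- give 8 b(n+2) = (n² + 3n + 16) 2ⁿ in all four cases.
module Submission where

open import Defs
open import Data.Fin.Base as Fin using (Fin; zero; suc; toℕ)
open import Data.Fin.Patterns using (0F; 1F; 2F; 3F)
open import Data.Integer.Base as ℤ using (ℤ; +_; 0ℤ; 1ℤ; -[1+_])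
import Data.Integer.Properties as ℤ
import Data.Integer.Tactic.RingSolver as ℤ
open import Data.List.Base
  using (List; []; _∷_; _++_; length; lookup; take; drop; tabulate; map; concatMap; applyUpTo)
import Data.List.Properties as List
open import Data.List.Membership.Propositional using (_∈_)
import Data.List.Membership.Propositional.Properties as ∈
open import Data.List.Membership.Propositional.Properties.WithK using (unique∧set⇒bag)
open import Data.List.Relation.Binary.BagAndSetEquality using (∼bag⇒↭)
open import Data.List.Relation.Binary.Permutation.Propositional.Properties using (↭-length)
open import Data.List.Relation.Binary.Sublist.Propositional
  using (_⊆_; []; _∷_; _∷ʳ_; minimum; from∈; ⊆-refl; ⊆-trans)
open import Data.List.Relation.Binary.Sublist.Propositional.Properties
  using (∷ˡ⁻; ∷⁻; All-resp-⊆; drop⁺)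
open import Data.List.Relation.Unary.All as All using (All; []; _∷_)
import Data.List.Relation.Unary.All.Properties as All
open import Data.List.Relation.Unary.AllPairs as AllPairs using (AllPairs; []; _∷_)
import Data.List.Relation.Unary.AllPairs.Properties as AllPairs
open import Data.List.Relation.Unary.Any using (here; there)
open import Data.List.Relation.Unary.Unique.Propositional using (Unique)
import Data.List.Relation.Unary.Unique.Propositional.Properties as Unique
open import Data.Nat.Base as ℕ using (ℕ; zero; suc; _∸_; _≤_; _<_; z≤n; s≤s; z<s; s<s)
open import Data.Nat.ListAction using (sum)
import Data.Nat.Properties as ℕ
open import Data.Nat.Tactic.RingSolver using (solve-∀)
open import Data.Product.Base using (∃-syntax; _×_; _,_; proj₁)
open import Data.Sum.Base as Sum using (_⊎_; inj₁; inj₂)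
open import Function.Base using (_∘_; _on_; id)
open import Function.Bundles using (_⇔_; mk⇔; Equivalence)
open import Relation.Binary.Core using (_Preserves_⟶_)
open import Relation.Binary.Definitions using (tri<; tri≈; tri>)
open import Relation.Binary.PropositionalEquality
  using (_≡_; refl; sym; trans; cong; cong₂; subst; subst₂; module ≡-Reasoning)
open import Relation.Nullary.Decidable using (dec-true; dec-false)
open import Relation.Nullary.Negation using (¬_; contradiction)

open import Algebra.Properties.CommutativeMonoid.Sum ℤ.+-0-commutativeMonoid
  renaming (sum to ∑) using ()
open Equivalence using (to; from)

-- Words read by an automaton

-- What keeps the automata small is the surplus of ascents over the largest entry: a new maximum may
-- exceed the old one by at most one plus that surplus. A new maximum never increases the surplus;
-- only reading the old maximum again after a 0 does. For 0010, 0100 and 0110 such a return forbids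
-- every later 0, so the surplus is at most 1 and a state needs only the parameter k, on which the
-- counts do not depend. For 0123 there can be many returns and the surplus is unbounded, so the
-- number a of ascents stays in the state. In exchange, once 1 has been read only one value above 1
-- can ever be used, and the choice of this value makes the counts linear in a.

unique-length : ∀ {A : Set} {xs ys : List A} → Unique xs → Unique ys →
                (∀ {x} → x ∈ xs ⇔ x ∈ ys) → length xs ≡ length ys
unique-length p q eq = ↭-length (∼bag⇒↭ (unique∧set⇒bag p q eq))

module Automaton {S : Set} (next : S → List (ℕ × S)) where

  runs : S → ℕ → List (List ℕ)
  continuations : ℕ → ℕ × S → List (List ℕ)

  runs s zero    = [] ∷ []
  runs s (suc n) = concatMap (continuations n) (next s)

  continuations n (x , s) = map (x ∷_) (runs s n)

  count : S → ℕ → ℕ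
  count s n = length (runs s n)

  count-suc : ∀ s n → count s (suc n) ≡ sum (map (λ (_ , t) → count t n) (next s))
  count-suc s n = go (next s)
    where
    open ≡-Reasoning
    go : ∀ ts → length (concatMap (continuations n) ts) ≡ sum (map (λ (_ , t) → count t n) ts)
    go []             = refl
    go ((x , t) ∷ ts) = begin
      length (map (x ∷_) (runs t n) ++ concatMap (continuations n) ts)
        ≡⟨ List.length-++ (map (x ∷_) (runs t n)) ⟩
      length (map (x ∷_) (runs t n)) ℕ.+ length (concatMap (continuations n) ts)
        ≡⟨ cong₂ ℕ._+_ (List.length-map (x ∷_) (runs t n)) (go ts) ⟩
      count t n ℕ.+ sum (map (λ (_ , t) → count t n) ts) ∎

  -- Strictly increasing letters in `next s` make the automaton deterministic: words through
  -- different successors already differ in their first letter.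
  runs-unique : (∀ s → AllPairs (_<_ on proj₁) (next s)) → ∀ s n → Unique (runs s n)
  runs-unique sorted s zero    = All.[] ∷ []
  runs-unique sorted s (suc n) = Unique.concat⁺
    (All.map⁺ (All.universal
      (λ (x , t) → Unique.map⁺ List.∷-injectiveʳ (runs-unique sorted t n)) (next s)))
    (AllPairs.map⁺ (AllPairs.map disjoint (sorted s)))
    where
    disjoint : ∀ {p q} → proj₁ p < proj₁ q → ∀ {w} →
               ¬ (w ∈ continuations n p × w ∈ continuations n q)
    disjoint x<y (w∈ , w∈′) with ∈.∈-map⁻ _ w∈ | ∈.∈-map⁻ _ w∈′
    ... | _ , _ , refl | _ , _ , refl = ℕ.<-irrefl refl x<y

  module _ {Sem : S → List ℕ → Set}
           (sem-[] : ∀ s → Sem s [])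
           (sem-∷ : ∀ s {x w} → Sem s (x ∷ w) ⇔ (∃[ t ] (x , t) ∈ next s × Sem t w)) where

    -- `Sem s` is the intended language of `s`. The hypotheses say that every state accepts and that
    -- removing a first letter leads to the language of a successor, so induction along the word
    -- identifies runs with the language.
    ∈-runs⁺ : ∀ s w → Sem s w → w ∈ runs s (length w)
    ∈-runs⁺ s []      p = here refl
    ∈-runs⁺ s (x ∷ w) p with to (sem-∷ s) p
    ... | t , xt∈ , q =
      ∈.∈-concat⁺′ (∈.∈-map⁺ (x ∷_) (∈-runs⁺ t w q)) (∈.∈-map⁺ (continuations (length w)) xt∈)

    ∈-runs⁻ : ∀ s n {w} → w ∈ runs s n → length w ≡ n × Sem s w
    ∈-runs⁻ s zero    (here refl) = refl , sem-[] s
    ∈-runs⁻ s (suc n) w∈ with ∈.∈-concat⁻′ (map (continuations n) (next s)) w∈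
    ... | _ , w∈′ , c∈ with ∈.∈-map⁻ (continuations n) c∈
    ... | (x , t) , xt∈ , refl with ∈.∈-map⁻ (x ∷_) w∈′
    ... | v , v∈ , refl with ∈-runs⁻ t n v∈
    ... | refl , q = refl , from (sem-∷ s) (t , xt∈ , q)

-- Continuations of 021-avoiding ascent sequences

-- The ascent condition on what follows a prefix with a ascents and last entry l. Keeping l in front
-- counts an ascent from the prefix into v; for a = l = 0 this is the condition on `0 ∷ v`.
Bounded : ℕ → ℕ → List ℕ → Set
Bounded a l v = ∀ (i : Fin (length v)) → lookup v i ≤ a ℕ.+ asc (l ∷ take (toℕ i) v) ℕ.+ 1

asc-< : ∀ {l x} a w → l < x → a ℕ.+ asc (l ∷ x ∷ w) ℕ.+ 1 ≡ suc a ℕ.+ asc (x ∷ w) ℕ.+ 1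
asc-< {l} {x} a w l<x rewrite dec-true (l ℕ.<? x) l<x = cong (ℕ._+ 1) (ℕ.+-suc a _)

asc-≮ : ∀ {l x} a w → ¬ l < x → a ℕ.+ asc (l ∷ x ∷ w) ℕ.+ 1 ≡ a ℕ.+ asc (x ∷ w) ℕ.+ 1
asc-≮ {l} {x} a w l≮x rewrite dec-false (l ℕ.<? x) l≮x = refl

a+0+1 : ∀ a → a ℕ.+ 0 ℕ.+ 1 ≡ suc a
a+0+1 a = trans (ℕ.+-assoc a 0 1) (ℕ.+-comm a 1)

bounded-head : ∀ {a l x v} → Bounded a l (x ∷ v) → x ≤ suc a
bounded-head {a} p = ℕ.≤-trans (p zero) (ℕ.≤-reflexive (a+0+1 a))

bounded-rise : ∀ {a l x v} → l < x → Bounded a l (x ∷ v) → Bounded (suc a) x v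
bounded-rise {a} {v = v} l<x p i =
  ℕ.≤-trans (p (suc i)) (ℕ.≤-reflexive (asc-< a (take (toℕ i) v) l<x))

bounded-level : ∀ {a l x v} → ¬ l < x → Bounded a l (x ∷ v) → Bounded a x v
bounded-level {a} {v = v} l≮x p i =
  ℕ.≤-trans (p (suc i)) (ℕ.≤-reflexive (asc-≮ a (take (toℕ i) v) l≮x))

rise-bounded : ∀ {a l x v} → l < x → x ≤ suc a → Bounded (suc a) x v → Bounded a l (x ∷ v)
rise-bounded {a} l<x x≤ p zero    = ℕ.≤-trans x≤ (ℕ.≤-reflexive (sym (a+0+1 a)))
rise-bounded {a} {v = v} l<x x≤ p (suc i) =
  ℕ.≤-trans (p i) (ℕ.≤-reflexive (sym (asc-< a (take (toℕ i) v) l<x)))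

level-bounded : ∀ {a l x v} → ¬ l < x → x ≤ suc a → Bounded a x v → Bounded a l (x ∷ v)
level-bounded {a} l≮x x≤ p zero    = ℕ.≤-trans x≤ (ℕ.≤-reflexive (sym (a+0+1 a)))
level-bounded {a} {v = v} l≮x x≤ p (suc i) =
  ℕ.≤-trans (p i) (ℕ.≤-reflexive (sym (asc-≮ a (take (toℕ i) v) l≮x)))

NoDescent : List ℕ → Set
NoDescent v = ∀ {x y} → x < y → ¬ (suc y ∷ suc x ∷ [] ⊆ v)

-- The possible continuations of a 021-avoiding ascent sequence with a ascents and
-- last entry l, where suc k is the largest entry (or k = 0 if all entries are zero).
data Tail : ℕ → ℕ → ℕ → List ℕ → Set where
  []   : ∀ {a k l} → Tail a k l []
  zero : ∀ {a k l w} → Tail a k 0 w → Tail a k l (0 ∷ w)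
  same : ∀ {a k w} → Tail a k (suc k) w → Tail a k (suc k) (suc k ∷ w)
  back : ∀ {a k w} → Tail (suc a) k (suc k) w → Tail a k 0 (suc k ∷ w)
  rise : ∀ {a k l j w} → k < j → j ≤ a → Tail (suc a) j (suc j) w → Tail a k l (suc j ∷ w)

-- As nonzero entries weakly increase, the last entry is always 0 or the maximum. Reading the
-- maximum again is an ascent in the first case (`back`) and not in the second (`same`), while a
-- larger letter is an ascent in both.
tail⁺ : ∀ {a k l} v → l ≡ 0 ⊎ l ≡ suc k → Bounded a l v →
        All (λ x → x ≡ 0 ⊎ k < x) v → NoDescent v → Tail a k l v
tail⁺ []      _ _  _              _  = []
tail⁺ (zero ∷ v) l bd (_ ∷ ≥k) nd =
  zero (tail⁺ v (inj₁ refl) (bounded-level {v = v} (λ ()) bd) ≥k (λ x<y → nd x<y ∘ (0 ∷ʳ_)))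
tail⁺ {k = k} (suc j ∷ v) l bd (inj₂ (s≤s k≤j) ∷ ≥k) nd with ℕ.m≤n⇒m<n∨m≡n k≤j
... | inj₁ k<j = rise k<j (ℕ.s≤s⁻¹ (bounded-head {v = v} bd))
  (tail⁺ v (inj₂ refl) (bounded-rise {v = v} (l<x l) bd) (All.tabulate ≥j)
    (λ x<y → nd x<y ∘ (suc j ∷ʳ_)))
  where
  l<x : ∀ {l} → l ≡ 0 ⊎ l ≡ suc k → l < suc j
  l<x (inj₁ refl) = z<s
  l<x (inj₂ refl) = s≤s k<j
  ≥j : ∀ {x} → x ∈ v → x ≡ 0 ⊎ j < x
  ≥j {zero}  _  = inj₁ refl
  ≥j {suc x} x∈ = inj₂ (ℕ.≮⇒≥ λ x<j → nd (ℕ.s≤s⁻¹ x<j) (refl ∷ from∈ x∈))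
tail⁺ (suc k ∷ v) (inj₁ refl) bd (_ ∷ ≥k) nd | inj₂ refl =
  back (tail⁺ v (inj₂ refl) (bounded-rise {v = v} z<s bd) ≥k (λ x<y → nd x<y ∘ (suc k ∷ʳ_)))
tail⁺ (suc k ∷ v) (inj₂ refl) bd (_ ∷ ≥k) nd | inj₂ refl =
  same (tail⁺ v (inj₂ refl) (bounded-level {v = v} (ℕ.n≮n _) bd) ≥k (λ x<y → nd x<y ∘ (suc k ∷ʳ_)))

-- `same` and `back` carry no bound on their letter `suc k`; it comes from `k ≤ a`, which persists
-- because `rise` demands `j ≤ a` and the number of ascents never drops.
tail⇒bounded : ∀ {a k l v} → l ≡ 0 ⊎ l ≡ suc k → k ≤ a → Tail a k l v → Bounded a l v
tail⇒bounded l k≤a []             = λ ()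
tail⇒bounded l k≤a (zero {w = w} t) =
  level-bounded {v = w} (λ ()) z≤n (tail⇒bounded (inj₁ refl) k≤a t)
tail⇒bounded l k≤a (same {w = w} t) =
  level-bounded {v = w} (ℕ.n≮n _) (s≤s k≤a) (tail⇒bounded (inj₂ refl) k≤a t)
tail⇒bounded l k≤a (back {w = w} t) =
  rise-bounded {v = w} z<s (s≤s k≤a) (tail⇒bounded (inj₂ refl) (ℕ.m≤n⇒m≤1+n k≤a) t)
tail⇒bounded l k≤a (rise {w = w} k<j j≤a t) =
  rise-bounded {v = w} (l<x l) (s≤s j≤a) (tail⇒bounded (inj₂ refl) (ℕ.m≤n⇒m≤1+n j≤a) t)
  where
  l<x : ∀ {l} → l ≡ 0 ⊎ l ≡ suc _ → l < suc _
  l<x (inj₁ refl) = z<s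
  l<x (inj₂ refl) = s≤s k<j

tail⇒≥ : ∀ {a k l v} → Tail a k l v → All (λ x → x ≡ 0 ⊎ k < x) v
tail⇒≥ []             = []
tail⇒≥ (zero t)       = inj₁ refl ∷ tail⇒≥ t
tail⇒≥ (same t)       = inj₂ ℕ.≤-refl ∷ tail⇒≥ t
tail⇒≥ (back t)       = inj₂ ℕ.≤-refl ∷ tail⇒≥ t
tail⇒≥ (rise k<j _ t) = inj₂ (ℕ.m<n⇒m<1+n k<j) ∷ All.map (Sum.map₂ (ℕ.<-trans k<j)) (tail⇒≥ t)

tail⇒noDescent : ∀ {a k l v} → Tail a k l v → NoDescent v
tail⇒noDescent t x<y = go t x<y
  where
  head : ∀ {a k l v} → Tail a k l v → ∀ {x} → x < k → ¬ (suc x ∷ [] ⊆ v)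
  head t x<k s with All-resp-⊆ s (tail⇒≥ t)
  ... | inj₂ k<1+x ∷ [] = ℕ.<⇒≱ x<k (ℕ.s≤s⁻¹ k<1+x)
  go : ∀ {a k l v} → Tail a k l v → NoDescent v
  go (zero t)     x<y (_ ∷ʳ s)   = go t x<y s
  go (same t)     x<y (_ ∷ʳ s)   = go t x<y s
  go (same t)     x<y (refl ∷ s) = head t x<y s
  go (back t)     x<y (_ ∷ʳ s)   = go t x<y s
  go (back t)     x<y (refl ∷ s) = head t x<y s
  go (rise _ _ t) x<y (_ ∷ʳ s)   = go t x<y s
  go (rise _ _ t) x<y (refl ∷ s) = head t x<y s

-- Pattern containment as subwords

drop-lookup : ∀ {A : Set} (xs : List A) i → drop (toℕ i) xs ≡ lookup xs i ∷ drop (suc (toℕ i)) xs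
drop-lookup (x ∷ xs) zero    = refl
drop-lookup (x ∷ xs) (suc i) = drop-lookup xs i

-- The induction in `go` runs over the suffix that starts at the first chosen position: the next
-- position lies strictly later, so its suffix embeds in what remains after the head.
tabulate-⊆ : ∀ {A : Set} (xs : List A) {m} (ι : Fin m → Fin (length xs)) →
             ι Preserves Fin._<_ ⟶ Fin._<_ → tabulate (lookup xs ∘ ι) ⊆ xs
tabulate-⊆ xs {zero}  ι inc = minimum xs
tabulate-⊆ xs {suc m} ι inc = ⊆-trans (go ι inc) (drop⁺ {m = toℕ (ι zero)} {n = 0} z≤n ⊆-refl)
  where
  go : ∀ {m} (ι : Fin (suc m) → Fin (length xs)) → ι Preserves Fin._<_ ⟶ Fin._<_ →
       tabulate (lookup xs ∘ ι) ⊆ drop (toℕ (ι zero)) xs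
  go {zero}  ι inc rewrite drop-lookup xs (ι zero) = refl ∷ minimum _
  go {suc m} ι inc rewrite drop-lookup xs (ι zero) =
    refl ∷ ⊆-trans (go (ι ∘ suc) (inc ∘ s<s)) (drop⁺ (inc z<s) ⊆-refl)

module _ (f : ℕ → ℕ) where

  embed : ∀ τ {π} → map f τ ⊆ π → Fin (length τ) → Fin (length π)
  embed (t ∷ τ) (_ ∷ʳ s) i       = suc (embed (t ∷ τ) s i)
  embed (t ∷ τ) (_ ∷ s)  zero    = zero
  embed (t ∷ τ) (_ ∷ s)  (suc i) = suc (embed τ s i)

  lookup-embed : ∀ τ {π} (s : map f τ ⊆ π) i → lookup π (embed τ s i) ≡ f (lookup τ i)
  lookup-embed (t ∷ τ) (_ ∷ʳ s)   i       = lookup-embed (t ∷ τ) s i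
  lookup-embed (t ∷ τ) (refl ∷ s) zero    = refl
  lookup-embed (t ∷ τ) (_ ∷ s)    (suc i) = lookup-embed τ s i

  embed-< : ∀ τ {π} (s : map f τ ⊆ π) → embed τ s Preserves Fin._<_ ⟶ Fin._<_
  embed-< (t ∷ τ) (_ ∷ʳ s)                i<j       = s<s (embed-< (t ∷ τ) s i<j)
  embed-< (t ∷ τ) (_ ∷ s) {zero}  {suc j} i<j       = z<s
  embed-< (t ∷ τ) (_ ∷ s) {suc i} {suc j} (s≤s i<j) = s<s (embed-< τ s i<j)

  module _ (f-step : ∀ n → f n < f (suc n)) where

    f-mono-< : ∀ {m n} → m < n → f m < f n
    f-mono-< {m} {suc n} (s≤s m≤n) with ℕ.m≤n⇒m<n∨m≡n m≤n
    ... | inj₁ m<n  = ℕ.<-trans (f-mono-< m<n) (f-step n)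
    ... | inj₂ refl = f-step n

    f-cancel-< : ∀ {m n} → f m < f n → m < n
    f-cancel-< {m} {n} fm<fn with ℕ.<-cmp m n
    ... | tri< m<n _ _  = m<n
    ... | tri≈ _ refl _ = contradiction fm<fn (ℕ.n≮n _)
    ... | tri> _ _ n<m  = contradiction fm<fn (ℕ.<-asym (f-mono-< n<m))

    f-injective : ∀ {m n} → f m ≡ f n → m ≡ n
    f-injective {m} {n} fm≡fn with ℕ.<-cmp m n
    ... | tri< m<n _ _ = contradiction fm≡fn (ℕ.<⇒≢ (f-mono-< m<n))
    ... | tri≈ _ eq _  = eq
    ... | tri> _ _ n<m = contradiction (sym fm≡fn) (ℕ.<⇒≢ (f-mono-< n<m))

    -- A strictly increasing relabelling preserves and reflects both order and equality. The
    -- relabellings used below prescribe the values at the letters of the pattern and continue with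
    -- slope one, so that the condition on consecutive numbers holds on all of ℕ.
    map-⊆⇒contains : ∀ τ {π} → map f τ ⊆ π → Contains π τ
    map-⊆⇒contains τ {π} s = embed τ s , record
      { increasing = embed-< τ s
      ; order      = λ j k → subst₂ (λ p q → p < q ⇔ _)
                                    (sym (lookup-embed τ s j)) (sym (lookup-embed τ s k))
                                    (mk⇔ f-cancel-< f-mono-<)
      ; equality   = λ j k → subst₂ (λ p q → p ≡ q ⇔ _)
                                    (sym (lookup-embed τ s j)) (sym (lookup-embed τ s k))
                                    (mk⇔ f-injective (cong f))
      }

-- Wherever the first pattern letter is placed in `x ∷ v`, the later ones lie to its right, hence in
-- v.
contains⇒⊆ : ∀ {x v t τ} ((ι , _) : Contains (x ∷ v) (t ∷ τ)) →
             tabulate (lookup (x ∷ v) ∘ ι ∘ suc) ⊆ v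
contains⇒⊆ {x} {v} (ι , occ) = ∷⁻ (tabulate-⊆ (x ∷ v) ι (IsOccurrence.increasing occ))

noDescent : ∀ {v} → Avoids (0 ∷ v) (0 ∷ 2 ∷ 1 ∷ []) → NoDescent v
noDescent av {x} {y} x<y s = av (map-⊆⇒contains f f-step (0 ∷ 2 ∷ 1 ∷ []) (refl ∷ s))
  where
  f : ℕ → ℕ
  f 0             = 0
  f 1             = suc x
  f (suc (suc n)) = suc (n ℕ.+ y)
  f-step : ∀ n → f n < f (suc n)
  f-step 0             = z<s
  f-step 1             = s<s x<y
  f-step (suc (suc n)) = ℕ.≤-refl

-- The letters that play 1 and 2 exceed the one that plays 0, so they are nonzero whatever that one
-- is.
avoids-021⁺ : ∀ {v} → NoDescent v → Avoids (0 ∷ v) (0 ∷ 2 ∷ 1 ∷ [])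
avoids-021⁺ {v} nd c@(ι , occ) =
  go (from (order 0F 2F) z<s) (from (order 2F 1F) ℕ.≤-refl) (contains⇒⊆ c)
  where
  open IsOccurrence occ
  go : ∀ {a b c} → a < b → b < c → ¬ (c ∷ b ∷ [] ⊆ v)
  go {b = suc _} {suc _} _ (s≤s b<c) = nd b<c

-- The relabelling of a pattern over 0 and 1 that fixes 0 and sends 1 to the nonzero value `suc x`.
scale : ℕ → ℕ → ℕ
scale x zero    = 0
scale x (suc n) = suc (n ℕ.+ x)

NoScaled : List ℕ → List ℕ → Set
NoScaled τ v = ∀ {x} → ¬ (map (scale x) τ ⊆ v)

noScaled : ∀ τ {v} → Avoids (0 ∷ v) (0 ∷ τ) → NoScaled τ v
noScaled τ av {x} s =
  av (map-⊆⇒contains (scale x) (λ { zero → z<s ; (suc n) → ℕ.≤-refl }) (0 ∷ τ) (refl ∷ s))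

-- If the pattern's 0 is played by a nonzero value, its last two distinct letters 1, 0 form a
-- descent between nonzero entries. So that value is 0, and the forbidden subword of v appears. The
-- same split serves 0100 and 0010.
avoids-0110⁺ : ∀ {v} → NoDescent v → NoScaled (1 ∷ 1 ∷ 0 ∷ []) v → Avoids (0 ∷ v) (0 ∷ 1 ∷ 1 ∷ 0 ∷ [])
avoids-0110⁺ {v} nd ns c@(ι , occ) =
  go (from (order 0F 1F) z<s) (from (equality 1F 2F) refl) (from (equality 0F 3F) refl) (contains⇒⊆ c)
  where
  open IsOccurrence occ
  go : ∀ {a b c d} → a < b → b ≡ c → a ≡ d → ¬ (b ∷ c ∷ d ∷ [] ⊆ v)
  go {zero}  {suc _} a<b       refl refl s = ns s
  go {suc _} {suc _} (s≤s a<b) refl refl s = nd a<b (∷ˡ⁻ s)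

avoids-0100⁺ : ∀ {v} → NoDescent v → NoScaled (1 ∷ 0 ∷ 0 ∷ []) v → Avoids (0 ∷ v) (0 ∷ 1 ∷ 0 ∷ 0 ∷ [])
avoids-0100⁺ {v} nd ns c@(ι , occ) =
  go (from (order 0F 1F) z<s) (from (equality 0F 2F) refl) (from (equality 0F 3F) refl) (contains⇒⊆ c)
  where
  open IsOccurrence occ
  go : ∀ {a b c d} → a < b → a ≡ c → a ≡ d → ¬ (b ∷ c ∷ d ∷ [] ⊆ v)
  go {zero}  {suc _} a<b       refl refl s = ns s
  go {suc _} {suc _} (s≤s a<b) refl refl s = nd a<b (⊆-trans (refl ∷ refl ∷ minimum _) s)

avoids-0010⁺ : ∀ {v} → NoDescent v → NoScaled (0 ∷ 1 ∷ 0 ∷ []) v → Avoids (0 ∷ v) (0 ∷ 0 ∷ 1 ∷ 0 ∷ [])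
avoids-0010⁺ {v} nd ns c@(ι , occ) =
  go (from (order 0F 2F) z<s) (from (equality 0F 1F) refl) (from (equality 0F 3F) refl) (contains⇒⊆ c)
  where
  open IsOccurrence occ
  go : ∀ {a b c d} → a < c → a ≡ b → a ≡ d → ¬ (b ∷ c ∷ d ∷ [] ⊆ v)
  go {zero}  {c = suc _} a<b       refl refl s = ns s
  go {suc _} {c = suc _} (s≤s a<b) refl refl s = nd a<b (∷ˡ⁻ s)

No123 : List ℕ → Set
No123 v = ∀ {x y z} → x < y → y < z → ¬ (suc x ∷ suc y ∷ suc z ∷ [] ⊆ v)

no123 : ∀ {v} → Avoids (0 ∷ v) (0 ∷ 1 ∷ 2 ∷ 3 ∷ []) → No123 v
no123 av {x} {y} {z} x<y y<z s = av (map-⊆⇒contains f f-step (0 ∷ 1 ∷ 2 ∷ 3 ∷ []) (refl ∷ s))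
  where
  f : ℕ → ℕ
  f 0                   = 0
  f 1                   = suc x
  f 2                   = suc y
  f (suc (suc (suc n))) = suc (n ℕ.+ z)
  f-step : ∀ n → f n < f (suc n)
  f-step 0                   = z<s
  f-step 1                   = s<s x<y
  f-step 2                   = s<s y<z
  f-step (suc (suc (suc n))) = ℕ.≤-refl

avoids-0123⁺ : ∀ {v} → No123 v → Avoids (0 ∷ v) (0 ∷ 1 ∷ 2 ∷ 3 ∷ [])
avoids-0123⁺ {v} no c@(ι , occ) =
  go (from (order 0F 1F) z<s) (from (order 1F 2F) ℕ.≤-refl) (from (order 2F 3F) ℕ.≤-refl) (contains⇒⊆ c)
  where
  open IsOccurrence occ
  go : ∀ {a b c d} → a < b → b < c → c < d → ¬ (b ∷ c ∷ d ∷ [] ⊆ v)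
  go {b = suc _} {suc _} {suc _} _ (s≤s b<c) (s≤s c<d) = no b<c c<d

-- P is what avoidance of τ by `0 ∷ v` becomes as a condition on v; going back to τ may use
-- `NoDescent`, which `Tail` provides.
B⇔ : ∀ {τ} {P : List ℕ → Set} → (∀ {v} → Avoids (0 ∷ v) τ → P v) →
     (∀ {v} → NoDescent v → P v → Avoids (0 ∷ v) τ) →
     ∀ {n w} → B τ (suc n) w ⇔ (∃[ v ] w ≡ 0 ∷ v × length v ≡ n × Tail 0 0 0 v × P v)
B⇔ {τ} {P} τ⇒P P⇒τ = mk⇔ ⇒ ⇐
  where
  ⇒ : ∀ {n w} → B τ (suc n) w → ∃[ v ] w ≡ 0 ∷ v × length v ≡ n × Tail 0 0 0 v × P v
  ⇒ {n} {x ∷ v} record { hasLength = refl ; isAscent = a ; avoids-021 = p ; avoids-τ = q }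
    with refl ← IsAscentSequence.starts a zero refl =
    v , refl , refl
      , tail⁺ v (inj₁ refl) (λ i → IsAscentSequence.bounded a (suc i) z<s) (All.universal 0≤ v) nd
      , τ⇒P q
    where
    nd = noDescent p
    0≤ : ∀ x → x ≡ 0 ⊎ 0 < x
    0≤ zero    = inj₁ refl
    0≤ (suc x) = inj₂ z<s
  ⇐ : ∀ {n w} → (∃[ v ] w ≡ 0 ∷ v × length v ≡ n × Tail 0 0 0 v × P v) → B τ (suc n) w
  ⇐ (v , refl , refl , t , p) = record
    { hasLength  = refl
    ; isAscent   = record
      { starts  = λ { zero _ → refl ; (suc _) () }
      ; bounded = λ { (suc i) _ → tail⇒bounded (inj₁ refl) z≤n t i }
      }
    ; avoids-021 = avoids-021⁺ nd
    ; avoids-τ   = P⇒τ nd p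
    }
    where nd = tail⇒noDescent t

-- The automata of the four patterns

-- In the states below k stands for the largest entry suc k of the prefix; the last
-- entry of the prefix is suc k in a high state and 0 in a low one.  The start states
-- follow a prefix of zeros.
data State : Set where
  zeroless₁ zeroless₂ : (k : ℕ) → State
  start-0110 : State
  high-0110 low-0110 : (k : ℕ) → State
  start-0100 : State
  high-0100 low-0100 : (k : ℕ) → State
  start-0010 zeros-0010 : State
  high-0010 low-0010 : (k : ℕ) → State
  start-0123 : State
  high-0123 low-0123 : (a : ℕ) → State
  high-max low-max : (a k : ℕ) → State

-- The first entry above 1 is the only other nonzero value that an extension may use.
maxima-0123 : ℕ → List (ℕ × State)
maxima-0123 a = applyUpTo (λ i → 2 ℕ.+ i , high-max (suc a) (suc i)) a

next : State → List (ℕ × State)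
next (zeroless₁ k)  = (suc k , zeroless₁ k) ∷ (2 ℕ.+ k , zeroless₁ (suc k)) ∷ []
next (zeroless₂ k)  = (suc k , zeroless₂ k) ∷ (2 ℕ.+ k , zeroless₂ (suc k))
                    ∷ (3 ℕ.+ k , zeroless₁ (2 ℕ.+ k)) ∷ []
next start-0110     = (0 , start-0110) ∷ (1 , high-0110 0) ∷ []
next (high-0110 k)  = (0 , low-0110 k) ∷ (suc k , zeroless₁ k) ∷ (2 ℕ.+ k , high-0110 (suc k)) ∷ []
next (low-0110 k)   = (0 , low-0110 k) ∷ (suc k , zeroless₂ k) ∷ (2 ℕ.+ k , high-0110 (suc k)) ∷ []
next start-0100     = (0 , start-0100) ∷ (1 , high-0100 0) ∷ []
next (high-0100 k)  = (0 , low-0100 k) ∷ (suc k , high-0100 k) ∷ (2 ℕ.+ k , high-0100 (suc k)) ∷ []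
next (low-0100 k)   = (suc k , zeroless₂ k) ∷ (2 ℕ.+ k , zeroless₁ (suc k)) ∷ []
next start-0010     = (0 , zeros-0010) ∷ (1 , high-0010 0) ∷ []
next zeros-0010     = (0 , zeros-0010) ∷ (1 , zeroless₁ 0) ∷ []
next (high-0010 k)  = (0 , low-0010 k) ∷ (suc k , high-0010 k) ∷ (2 ℕ.+ k , high-0010 (suc k)) ∷ []
next (low-0010 k)   = (0 , low-0010 k) ∷ (suc k , zeroless₂ k) ∷ (2 ℕ.+ k , zeroless₁ (suc k)) ∷ []
next start-0123     = (0 , start-0123) ∷ (1 , high-0123 1) ∷ []
next (high-0123 a)  = (0 , low-0123 a) ∷ (1 , high-0123 a) ∷ maxima-0123 a
next (low-0123 a)   = (0 , low-0123 a) ∷ (1 , high-0123 (suc a)) ∷ maxima-0123 a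
next (high-max a k) = (0 , low-max a k) ∷ (suc k , high-max a k) ∷ []
next (low-max a k)  = (0 , low-max a k) ∷ (suc k , high-max (suc a) k) ∷ []

Sorted : List (ℕ × State) → Set
Sorted = AllPairs (_<_ on proj₁)

next-sorted : ∀ s → Sorted (next s)
next-sorted = go
  where
  pair : ∀ {x y} {s t : State} → x < y → Sorted ((x , s) ∷ (y , t) ∷ [])
  pair x<y = (x<y ∷ []) ∷ [] ∷ []
  triple : ∀ {x y z} {s t u : State} → x < y → y < z →
           Sorted ((x , s) ∷ (y , t) ∷ (z , u) ∷ [])
  triple x<y y<z = (x<y ∷ ℕ.<-trans x<y y<z ∷ []) ∷ pair y<z
  many : ∀ {s t : State} {f : ℕ → State} n →
         Sorted ((0 , s) ∷ (1 , t) ∷ applyUpTo (λ i → 2 ℕ.+ i , f i) n)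
  many n = (z<s ∷ All.applyUpTo⁺₂ _ n (λ _ → z<s))
         ∷ All.applyUpTo⁺₂ _ n (λ _ → s<s z<s)
         ∷ AllPairs.applyUpTo⁺₁ _ n (λ i<j _ → s<s (s<s i<j))
  go : ∀ s → Sorted (next s)
  go (zeroless₁ k)  = pair ℕ.≤-refl
  go (zeroless₂ k)  = triple ℕ.≤-refl ℕ.≤-refl
  go start-0110     = pair z<s
  go (high-0110 k)  = triple z<s ℕ.≤-refl
  go (low-0110 k)   = triple z<s ℕ.≤-refl
  go start-0100     = pair z<s
  go (high-0100 k)  = triple z<s ℕ.≤-refl
  go (low-0100 k)   = pair ℕ.≤-refl
  go start-0010     = pair z<s
  go zeros-0010     = pair z<s
  go (high-0010 k)  = triple z<s ℕ.≤-refl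
  go (low-0010 k)   = triple z<s ℕ.≤-refl
  go start-0123     = pair z<s
  go (high-0123 a)  = many a
  go (low-0123 a)   = many a
  go (high-max a k) = pair z<s
  go (low-max a k)  = pair z<s

-- The languages of the states

Zeroless : List ℕ → Set
Zeroless w = ¬ (0 ∷ [] ⊆ w)

No23 : List ℕ → Set
No23 w = ∀ {y z} → 0 < y → y < z → ¬ (suc y ∷ suc z ∷ [] ⊆ w)

AtMost : ℕ → List ℕ → Set
AtMost k w = ∀ {z} → k < z → ¬ (suc z ∷ [] ⊆ w)

-- In `zeroless₁` the ascents equal the largest entry `suc k`; in `zeroless₂` there is one more,
-- gained by returning to the maximum after a 0. For 0110 only the maximum has to be remembered as
-- seen, since smaller nonzero entries cannot recur. For 0123 the entry 1 has been seen, so `No23`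
-- forbids two increasing values above it; once such a value is chosen, `AtMost` leaves only that
-- value and 0.
Sem : State → List ℕ → Set
Sem (zeroless₁ k)  w = Tail (suc k) k (suc k) w × Zeroless w
Sem (zeroless₂ k)  w = Tail (2 ℕ.+ k) k (suc k) w × Zeroless w
Sem start-0110     w = Tail 0 0 0 w × NoScaled (1 ∷ 1 ∷ 0 ∷ []) w
Sem (high-0110 k)  w = Tail (suc k) k (suc k) w × NoScaled (1 ∷ 1 ∷ 0 ∷ []) w × ¬ (suc k ∷ 0 ∷ [] ⊆ w)
Sem (low-0110 k)   w = Tail (suc k) k 0 w × NoScaled (1 ∷ 1 ∷ 0 ∷ []) w × ¬ (suc k ∷ 0 ∷ [] ⊆ w)
Sem start-0100     w = Tail 0 0 0 w × NoScaled (1 ∷ 0 ∷ 0 ∷ []) w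
Sem (high-0100 k)  w = Tail (suc k) k (suc k) w × ¬ (0 ∷ 0 ∷ [] ⊆ w)
Sem (low-0100 k)   w = Tail (suc k) k 0 w × Zeroless w
Sem start-0010     w = Tail 0 0 0 w × NoScaled (0 ∷ 1 ∷ 0 ∷ []) w
Sem zeros-0010     w = Tail 0 0 0 w × NoScaled (1 ∷ 0 ∷ []) w
Sem (high-0010 k)  w = Tail (suc k) k (suc k) w × NoScaled (0 ∷ 1 ∷ 0 ∷ []) w
Sem (low-0010 k)   w = Tail (suc k) k 0 w × NoScaled (1 ∷ 0 ∷ []) w
Sem start-0123     w = Tail 0 0 0 w × No123 w
Sem (high-0123 a)  w = Tail a 0 1 w × No23 w
Sem (low-0123 a)   w = Tail a 0 0 w × No23 w
Sem (high-max a k) w = Tail a k (suc k) w × AtMost k w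
Sem (low-max a k)  w = Tail a k 0 w × AtMost k w

sem-[] : ∀ s → Sem s []
sem-[] (zeroless₁ k)  = [] , λ ()
sem-[] (zeroless₂ k)  = [] , λ ()
sem-[] start-0110     = [] , λ ()
sem-[] (high-0110 k)  = [] , (λ ()) , λ ()
sem-[] (low-0110 k)   = [] , (λ ()) , λ ()
sem-[] start-0100     = [] , λ ()
sem-[] (high-0100 k)  = [] , λ ()
sem-[] (low-0100 k)   = [] , λ ()
sem-[] start-0010     = [] , λ ()
sem-[] zeros-0010     = [] , λ ()
sem-[] (high-0010 k)  = [] , λ ()
sem-[] (low-0010 k)   = [] , λ ()
sem-[] start-0123     = [] , λ _ _ ()
sem-[] (high-0123 a)  = [] , λ _ _ ()
sem-[] (low-0123 a)   = [] , λ _ _ ()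
sem-[] (high-max a k) = [] , λ _ ()
sem-[] (low-max a k)  = [] , λ _ ()

pattern 1st = here refl
pattern 2nd = there (here refl)
pattern 3rd = there (there (here refl))

Successor : State → ℕ → List ℕ → Set
Successor s x w = ∃[ t ] (x , t) ∈ next s × Sem t w

-- Without surplus, a new maximum exceeds the old one by exactly one.
rise-to-top : ∀ {k j} → k < j → j ≤ suc k → j ≡ suc k
rise-to-top k<j j≤1+k = ℕ.≤-antisym j≤1+k k<j

-- Each way to extend a `Tail` is matched with one transition. Composing with `_ ∷ʳ_` passes a
-- restriction on unchanged; composing with `refl ∷_` uses the letter as the first of the forbidden
-- subword and leaves the rest of it forbidden.
sem⇒successor : ∀ s {x w} → Sem s (x ∷ w) → Successor s x w
sem⇒successor (zeroless₁ k) (zero t , z) = contradiction (refl ∷ minimum _) z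
sem⇒successor (zeroless₁ k) (same t , z) = _ , 1st , t , z ∘ (_ ∷ʳ_)
sem⇒successor (zeroless₁ k) (rise k<j j≤ t , z)
  with refl ← rise-to-top k<j j≤ = _ , 2nd , t , z ∘ (_ ∷ʳ_)
sem⇒successor (zeroless₂ k) (zero t , z) = contradiction (refl ∷ minimum _) z
sem⇒successor (zeroless₂ k) (same t , z) = _ , 1st , t , z ∘ (_ ∷ʳ_)
sem⇒successor (zeroless₂ k) (rise k<j j≤ t , z) with ℕ.m≤n⇒m<n∨m≡n j≤
... | inj₁ (s≤s j≤1+k) with refl ← rise-to-top k<j j≤1+k = _ , 2nd , t , z ∘ (_ ∷ʳ_)
-- Jumping by two uses up the surplus, whereas a rise by one keeps it.
... | inj₂ refl = _ , 3rd , t , z ∘ (_ ∷ʳ_)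
sem⇒successor start-0110 (zero t , n) = _ , 1st , t , n ∘ (_ ∷ʳ_)
-- After zeros only, k = 0 makes the first nonzero letter 1 a `back`; a `rise` would need 0 < j ≤ 0.
sem⇒successor start-0110 (back t , n) = _ , 2nd , t , n ∘ (_ ∷ʳ_) , n ∘ (refl ∷_)
sem⇒successor start-0110 (rise () z≤n _ , _)
sem⇒successor (high-0110 k) (zero t , n , m) = _ , 1st , t , n ∘ (_ ∷ʳ_) , m ∘ (_ ∷ʳ_)
-- With `suc k` now read twice, any 0 completes the forbidden subword. Both earlier restrictions end
-- in 0, so absence of zeros subsumes them.
sem⇒successor (high-0110 k) (same t , n , m) = _ , 2nd , t , m ∘ (refl ∷_)
sem⇒successor (high-0110 k) (rise k<j j≤ t , n , m)
  with refl ← rise-to-top k<j j≤ = _ , 3rd , t , n ∘ (_ ∷ʳ_) , n ∘ (refl ∷_)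
sem⇒successor (low-0110 k) (zero t , n , m) = _ , 1st , t , n ∘ (_ ∷ʳ_) , m ∘ (_ ∷ʳ_)
sem⇒successor (low-0110 k) (back t , n , m) = _ , 2nd , t , m ∘ (refl ∷_)
sem⇒successor (low-0110 k) (rise k<j j≤ t , n , m)
  with refl ← rise-to-top k<j j≤ = _ , 3rd , t , n ∘ (_ ∷ʳ_) , n ∘ (refl ∷_)
sem⇒successor start-0100 (zero t , n) = _ , 1st , t , n ∘ (_ ∷ʳ_)
sem⇒successor start-0100 (back t , n) = _ , 2nd , t , n ∘ (refl ∷_)
sem⇒successor start-0100 (rise () z≤n _ , _)
sem⇒successor (high-0100 k) (zero t , n) = _ , 1st , t , n ∘ (refl ∷_)
sem⇒successor (high-0100 k) (same t , n) = _ , 2nd , t , n ∘ (_ ∷ʳ_)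
sem⇒successor (high-0100 k) (rise k<j j≤ t , n)
  with refl ← rise-to-top k<j j≤ = _ , 3rd , t , n ∘ (_ ∷ʳ_)
sem⇒successor (low-0100 k) (zero t , z) = contradiction (refl ∷ minimum _) z
sem⇒successor (low-0100 k) (back t , z) = _ , 1st , t , z ∘ (_ ∷ʳ_)
sem⇒successor (low-0100 k) (rise k<j j≤ t , z)
  with refl ← rise-to-top k<j j≤ = _ , 2nd , t , z ∘ (_ ∷ʳ_)
sem⇒successor start-0010 (zero t , n) = _ , 1st , t , n ∘ (refl ∷_)
sem⇒successor start-0010 (back t , n) = _ , 2nd , t , n ∘ (_ ∷ʳ_)
sem⇒successor start-0010 (rise () z≤n _ , _)
sem⇒successor zeros-0010 (zero t , n) = _ , 1st , t , n ∘ (_ ∷ʳ_)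
sem⇒successor zeros-0010 (back t , n) = _ , 2nd , t , n ∘ (refl ∷_)
sem⇒successor zeros-0010 (rise () z≤n _ , _)
sem⇒successor (high-0010 k) (zero t , n) = _ , 1st , t , n ∘ (refl ∷_)
sem⇒successor (high-0010 k) (same t , n) = _ , 2nd , t , n ∘ (_ ∷ʳ_)
sem⇒successor (high-0010 k) (rise k<j j≤ t , n)
  with refl ← rise-to-top k<j j≤ = _ , 3rd , t , n ∘ (_ ∷ʳ_)
sem⇒successor (low-0010 k) (zero t , n) = _ , 1st , t , n ∘ (_ ∷ʳ_)
sem⇒successor (low-0010 k) (back t , n) = _ , 2nd , t , n ∘ (refl ∷_)
sem⇒successor (low-0010 k) (rise k<j j≤ t , n)
  with refl ← rise-to-top k<j j≤ = _ , 3rd , t , n ∘ (refl ∷_)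
sem⇒successor start-0123 (zero t , n) = _ , 1st , t , λ x<y y<z → n x<y y<z ∘ (_ ∷ʳ_)
sem⇒successor start-0123 (back t , n) = _ , 2nd , t , λ 0<y y<z → n 0<y y<z ∘ (refl ∷_)
sem⇒successor start-0123 (rise () z≤n _ , _)
sem⇒successor (high-0123 a) (zero t , n) = _ , 1st , t , λ 0<y y<z → n 0<y y<z ∘ (_ ∷ʳ_)
sem⇒successor (high-0123 a) (same t , n) = _ , 2nd , t , λ 0<y y<z → n 0<y y<z ∘ (_ ∷ʳ_)
sem⇒successor (high-0123 a) (rise {j = suc i} 0<j j≤a t , n) =
  _ , there (there (∈.∈-applyUpTo⁺ _ j≤a)) , t , λ j<z → n 0<j j<z ∘ (refl ∷_)
sem⇒successor (low-0123 a) (zero t , n) = _ , 1st , t , λ 0<y y<z → n 0<y y<z ∘ (_ ∷ʳ_)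
sem⇒successor (low-0123 a) (back t , n) = _ , 2nd , t , λ 0<y y<z → n 0<y y<z ∘ (_ ∷ʳ_)
sem⇒successor (low-0123 a) (rise {j = suc i} 0<j j≤a t , n) =
  _ , there (there (∈.∈-applyUpTo⁺ _ j≤a)) , t , λ j<z → n 0<j j<z ∘ (refl ∷_)
sem⇒successor (high-max a k) (zero t , m) = _ , 1st , t , λ k<z → m k<z ∘ (_ ∷ʳ_)
sem⇒successor (high-max a k) (same t , m) = _ , 2nd , t , λ k<z → m k<z ∘ (_ ∷ʳ_)
sem⇒successor (high-max a k) (rise k<j _ _ , m) = contradiction (refl ∷ minimum _) (m k<j)
sem⇒successor (low-max a k) (zero t , m) = _ , 1st , t , λ k<z → m k<z ∘ (_ ∷ʳ_)
sem⇒successor (low-max a k) (back t , m) = _ , 2nd , t , λ k<z → m k<z ∘ (_ ∷ʳ_)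
sem⇒successor (low-max a k) (rise k<j _ _ , m) = contradiction (refl ∷ minimum _) (m k<j)

-- Rebuilding the language of a state from its successors

zeroless-∷ : ∀ {x w} → Zeroless w → Zeroless (suc x ∷ w)
zeroless-∷ z (_ ∷ʳ s) = z s

no23-skip : ∀ {x w} → x ≤ 1 → No23 w → No23 (x ∷ w)
no23-skip x≤1       n 0<y y<z (_ ∷ʳ s)   = n 0<y y<z s
no23-skip (s≤s z≤n) n ()  y<z (refl ∷ s)

-- Later nonzero entries are at least `suc k`, so an increasing pair among them would end above
-- `suc k`, against `AtMost`.
no23-max : ∀ {a k l w} → Tail a k l w → AtMost k w → No23 (suc k ∷ w)
no23-max t m 0<y y<z (refl ∷ s) = m y<z s
no23-max t m 0<y y<z (_ ∷ʳ s) with inj₂ k<1+y ∷ _ ← All-resp-⊆ s (tail⇒≥ t) =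
  m (ℕ.≤-<-trans (ℕ.s≤s⁻¹ k<1+y) y<z) (∷ˡ⁻ s)

atMost-∷ : ∀ {k w} → AtMost k w → AtMost k (suc k ∷ w)
atMost-∷ m k<z (_ ∷ʳ s)   = m k<z s
atMost-∷ m k<z (refl ∷ s) = ℕ.n≮n _ k<z

-- The successor only records the new maximum. The restriction on the old maximum `suc k` is
-- recovered from the tail, where `suc k` cannot occur again.
high-0110-∷ : ∀ {k l} w → Sem (high-0110 (suc k)) w → l ≡ 0 ⊎ l ≡ suc k →
  Tail (suc k) k l (2 ℕ.+ k ∷ w) × NoScaled (1 ∷ 1 ∷ 0 ∷ []) (2 ℕ.+ k ∷ w) ×
  ¬ (suc k ∷ 0 ∷ [] ⊆ 2 ℕ.+ k ∷ w)
high-0110-∷ {k} w (t , n , m) l =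
  rise ℕ.≤-refl ℕ.≤-refl t , (λ { (_ ∷ʳ s) → n s ; (refl ∷ s) → m s }) , λ { (_ ∷ʳ s) → smaller (All-resp-⊆ s (tail⇒≥ t)) }
  where
  smaller : ¬ All (λ x → x ≡ 0 ⊎ suc k < x) (suc k ∷ 0 ∷ [])
  smaller (inj₂ k<k ∷ _) = ℕ.n≮n _ k<k

successor⇒sem : ∀ s {x w} → Successor s x w → Sem s (x ∷ w)
successor⇒sem (zeroless₁ k) (_ , 1st , t , z) = same t , zeroless-∷ z
successor⇒sem (zeroless₁ k) (_ , 2nd , t , z) = rise ℕ.≤-refl ℕ.≤-refl t , zeroless-∷ z
successor⇒sem (zeroless₂ k) (_ , 1st , t , z) = same t , zeroless-∷ z
successor⇒sem (zeroless₂ k) (_ , 2nd , t , z) = rise ℕ.≤-refl (ℕ.n≤1+n _) t , zeroless-∷ z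
successor⇒sem (zeroless₂ k) (_ , 3rd , t , z) = rise (ℕ.n≤1+n _) ℕ.≤-refl t , zeroless-∷ z
successor⇒sem start-0110 (_ , 1st , t , n) = zero t , λ { (_ ∷ʳ s) → n s }
successor⇒sem start-0110 (_ , 2nd , t , n , m) = back t , λ { (_ ∷ʳ s) → n s ; (refl ∷ s) → m s }
successor⇒sem (high-0110 k) (_ , 1st , t , n , m) =
  zero t , (λ { (_ ∷ʳ s) → n s }) , λ { (_ ∷ʳ s) → m s }
successor⇒sem (high-0110 k) (_ , 2nd , t , z) =
  same t , (λ s → z (∷ˡ⁻ (∷⁻ s))) , λ s → z (∷⁻ s)
successor⇒sem (high-0110 k) (_ , 3rd , p) = high-0110-∷ _ p (inj₂ refl)
successor⇒sem (low-0110 k) (_ , 1st , t , n , m) =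
  zero t , (λ { (_ ∷ʳ s) → n s }) , λ { (_ ∷ʳ s) → m s }
successor⇒sem (low-0110 k) (_ , 2nd , t , z) =
  back t , (λ s → z (∷ˡ⁻ (∷⁻ s))) , λ s → z (∷⁻ s)
successor⇒sem (low-0110 k) (_ , 3rd , p) = high-0110-∷ _ p (inj₁ refl)
successor⇒sem start-0100 (_ , 1st , t , n) = zero t , λ { (_ ∷ʳ s) → n s }
successor⇒sem start-0100 (_ , 2nd , t , n) = back t , λ s → n (∷⁻ s)
successor⇒sem (high-0100 k) (_ , 1st , t , z) = zero t , λ s → z (∷⁻ s)
successor⇒sem (high-0100 k) (_ , 2nd , t , n) = same t , λ { (_ ∷ʳ s) → n s }
successor⇒sem (high-0100 k) (_ , 3rd , t , n) = rise ℕ.≤-refl ℕ.≤-refl t , λ { (_ ∷ʳ s) → n s }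
successor⇒sem (low-0100 k) (_ , 1st , t , z) = back t , zeroless-∷ z
successor⇒sem (low-0100 k) (_ , 2nd , t , z) = rise ℕ.≤-refl ℕ.≤-refl t , zeroless-∷ z
successor⇒sem start-0010 (_ , 1st , t , n) = zero t , λ s → n (∷⁻ s)
successor⇒sem start-0010 (_ , 2nd , t , n) = back t , λ { (_ ∷ʳ s) → n s }
successor⇒sem zeros-0010 (_ , 1st , t , n) = zero t , λ { (_ ∷ʳ s) → n s }
successor⇒sem zeros-0010 (_ , 2nd , t , z) = back t , λ s → z (∷⁻ s)
successor⇒sem (high-0010 k) (_ , 1st , t , n) = zero t , λ s → n (∷⁻ s)
successor⇒sem (high-0010 k) (_ , 2nd , t , n) = same t , λ { (_ ∷ʳ s) → n s }
successor⇒sem (high-0010 k) (_ , 3rd , t , n) = rise ℕ.≤-refl ℕ.≤-refl t , λ { (_ ∷ʳ s) → n s }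
successor⇒sem (low-0010 k) (_ , 1st , t , n) = zero t , λ { (_ ∷ʳ s) → n s }
successor⇒sem (low-0010 k) (_ , 2nd , t , z) = back t , λ s → z (∷⁻ s)
successor⇒sem (low-0010 k) (_ , 3rd , t , z) = rise ℕ.≤-refl ℕ.≤-refl t , λ s → z (∷⁻ s)
successor⇒sem start-0123 (_ , 1st , t , n) = zero t , λ { x<y y<z (_ ∷ʳ s) → n x<y y<z s }
successor⇒sem start-0123 (_ , 2nd , t , n) =
  back t , λ x<y y<z s → n (ℕ.≤-<-trans z≤n x<y) y<z (∷⁻ s)
successor⇒sem (high-0123 a) (_ , 1st , t , n) = zero t , no23-skip z≤n n
successor⇒sem (high-0123 a) (_ , 2nd , t , n) = same t , no23-skip ℕ.≤-refl n
successor⇒sem (high-0123 a) (_ , there (there x∈) , p)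
  with i , i<a , refl ← ∈.∈-applyUpTo⁻ _ x∈ = let t , m = p in rise z<s i<a t , no23-max t m
successor⇒sem (low-0123 a) (_ , 1st , t , n) = zero t , no23-skip z≤n n
successor⇒sem (low-0123 a) (_ , 2nd , t , n) = back t , no23-skip ℕ.≤-refl n
successor⇒sem (low-0123 a) (_ , there (there x∈) , p)
  with i , i<a , refl ← ∈.∈-applyUpTo⁻ _ x∈ = let t , m = p in rise z<s i<a t , no23-max t m
successor⇒sem (high-max a k) (_ , 1st , t , m) = zero t , λ { k<z (_ ∷ʳ s) → m k<z s }
successor⇒sem (high-max a k) (_ , 2nd , t , m) = same t , atMost-∷ m
successor⇒sem (low-max a k) (_ , 1st , t , m) = zero t , λ { k<z (_ ∷ʳ s) → m k<z s }
successor⇒sem (low-max a k) (_ , 2nd , t , m) = back t , atMost-∷ m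

-- Counting runs

open Automaton next

sem-∷ : ∀ s {x w} → Sem s (x ∷ w) ⇔ Successor s x w
sem-∷ s = mk⇔ (sem⇒successor s) (successor⇒sem s)

b-count : ∀ {τ} (P : List ℕ → Set) s → (∀ {v} → Avoids (0 ∷ v) τ → P v) →
          (∀ {v} → NoDescent v → P v → Avoids (0 ∷ v) τ) →
          (∀ {v} → Sem s v ≡ (Tail 0 0 0 v × P v)) → ∀ n → b τ (suc n) ≡ count s n
b-count {τ} P s τ⇒P P⇒τ sem n = trans
  (unique-length (enumerate-unique τ (suc n))
    (Unique.map⁺ List.∷-injectiveʳ (runs-unique next-sorted s n)) (mk⇔ ⇒ ⇐))
  (List.length-map (0 ∷_) (runs s n))
  where
  ⇒ : ∀ {w} → w ∈ enumerate τ (suc n) → w ∈ map (0 ∷_) (runs s n)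
  ⇒ w∈ with v , refl , refl , tp ← to (B⇔ τ⇒P P⇒τ) (to (∈-enumerate τ (suc n) _) w∈) =
    ∈.∈-map⁺ (0 ∷_) (∈-runs⁺ sem-[] sem-∷ s v (subst id (sym sem) tp))
  ⇐ : ∀ {w} → w ∈ map (0 ∷_) (runs s n) → w ∈ enumerate τ (suc n)
  ⇐ w∈ with v , v∈ , refl ← ∈.∈-map⁻ (0 ∷_) w∈
       with len , p ← ∈-runs⁻ sem-[] sem-∷ s n v∈ =
    from (∈-enumerate τ (suc n) _) (from (B⇔ τ⇒P P⇒τ) (v , refl , len , subst id sem p))

-- The multiplier c clears the denominators of the closed forms, so the recurrences can be solved
-- within ℕ.
count-step₂ : ∀ c s {x y t u} n {p q r} → next s ≡ (x , t) ∷ (y , u) ∷ [] →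
              c ℕ.* count t n ≡ p → c ℕ.* count u n ≡ q → p ℕ.+ q ≡ r →
              c ℕ.* count s (suc n) ≡ r
count-step₂ c s {t = t} {u} n eq refl refl refl rewrite count-suc s n | eq =
  distrib c (count t n) (count u n)
  where
  distrib : ∀ c x y → c ℕ.* (x ℕ.+ (y ℕ.+ 0)) ≡ c ℕ.* x ℕ.+ c ℕ.* y
  distrib = solve-∀

count-step₃ : ∀ c s {x y z t u v} n {p q r e} → next s ≡ (x , t) ∷ (y , u) ∷ (z , v) ∷ [] →
              c ℕ.* count t n ≡ p → c ℕ.* count u n ≡ q → c ℕ.* count v n ≡ r → p ℕ.+ q ℕ.+ r ≡ e →
              c ℕ.* count s (suc n) ≡ e
count-step₃ c s {t = t} {u} {v} n eq refl refl refl refl rewrite count-suc s n | eq =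
  distrib c (count t n) (count u n) (count v n)
  where
  distrib : ∀ c x y z → c ℕ.* (x ℕ.+ (y ℕ.+ (z ℕ.+ 0))) ≡ c ℕ.* x ℕ.+ c ℕ.* y ℕ.+ c ℕ.* z
  distrib = solve-∀

quadruple : ∀ x {p} → 2 ℕ.* x ≡ p → 8 ℕ.* x ≡ 4 ℕ.* p
quadruple x refl = ℕ.*-assoc 4 2 x

count-zeroless₁ : ∀ k n → count (zeroless₁ k) n ≡ 2 ℕ.^ n
count-zeroless₁ k zero    = refl
count-zeroless₁ k (suc n) = trans (count-suc (zeroless₁ k) n)
  (cong₂ (λ x y → x ℕ.+ (y ℕ.+ 0)) (count-zeroless₁ k n) (count-zeroless₁ (suc k) n))

-- The count doubles and gains 2ⁿ from the jump by two; this resonance with the root 2 produces the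
-- linear factor.
count-zeroless₂ : ∀ k n → 2 ℕ.* count (zeroless₂ k) n ≡ (n ℕ.+ 2) ℕ.* 2 ℕ.^ n
count-zeroless₂ k zero    = refl
count-zeroless₂ k (suc n) = count-step₃ 2 (zeroless₂ k) n refl
  (count-zeroless₂ k n) (count-zeroless₂ (suc k) n) (cong (2 ℕ.*_) (count-zeroless₁ (2 ℕ.+ k) n))
  (step n (2 ℕ.^ n))
  where
  step : ∀ n e → (n ℕ.+ 2) ℕ.* e ℕ.+ (n ℕ.+ 2) ℕ.* e ℕ.+ 2 ℕ.* e ≡ (suc n ℕ.+ 2) ℕ.* (2 ℕ.* e)
  step = solve-∀

-- Eight times the numbers of words of length suc n.
startCount highCount lowCount : ℕ → ℕ
startCount n = (n ℕ.* n ℕ.+ 3 ℕ.* n ℕ.+ 16) ℕ.* 2 ℕ.^ n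
highCount  n = (n ℕ.* n ℕ.+ 7 ℕ.* n ℕ.+ 24) ℕ.* 2 ℕ.^ n
lowCount   n = (n ℕ.* n ℕ.+ 11 ℕ.* n ℕ.+ 24) ℕ.* 2 ℕ.^ n

startCount-step : ∀ n → startCount n ℕ.+ highCount n ≡ startCount (suc n)
startCount-step n = step n (2 ℕ.^ n)
  where
  step : ∀ n e → (n ℕ.* n ℕ.+ 3 ℕ.* n ℕ.+ 16) ℕ.* e ℕ.+ (n ℕ.* n ℕ.+ 7 ℕ.* n ℕ.+ 24) ℕ.* e
               ≡ (suc n ℕ.* suc n ℕ.+ 3 ℕ.* suc n ℕ.+ 16) ℕ.* (2 ℕ.* e)
  step = solve-∀

-- High and low states feed each other. Their recurrences differ only in repeating the maximum,
-- which leads to `zeroless₁` from a high state but, being an ascent, to `zeroless₂` from a low one.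
count-high-0110 : ∀ k n → 8 ℕ.* count (high-0110 k) (suc n) ≡ highCount n
count-low-0110  : ∀ k n → 8 ℕ.* count (low-0110 k) (suc n) ≡ lowCount n

count-high-0110 k zero    = refl
count-high-0110 k (suc n) = count-step₃ 8 (high-0110 k) (suc n) refl
  (count-low-0110 k n) (cong (8 ℕ.*_) (count-zeroless₁ k (suc n))) (count-high-0110 (suc k) n)
  (step n (2 ℕ.^ n))
  where
  step : ∀ n e → (n ℕ.* n ℕ.+ 11 ℕ.* n ℕ.+ 24) ℕ.* e ℕ.+ 8 ℕ.* (2 ℕ.* e)
                 ℕ.+ (n ℕ.* n ℕ.+ 7 ℕ.* n ℕ.+ 24) ℕ.* e
               ≡ (suc n ℕ.* suc n ℕ.+ 7 ℕ.* suc n ℕ.+ 24) ℕ.* (2 ℕ.* e)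
  step = solve-∀

count-low-0110 k zero    = refl
count-low-0110 k (suc n) = count-step₃ 8 (low-0110 k) (suc n) refl
  (count-low-0110 k n) (quadruple (count (zeroless₂ k) (suc n)) (count-zeroless₂ k (suc n)))
  (count-high-0110 (suc k) n)
  (step n (2 ℕ.^ n))
  where
  step : ∀ n e → (n ℕ.* n ℕ.+ 11 ℕ.* n ℕ.+ 24) ℕ.* e ℕ.+ 4 ℕ.* ((suc n ℕ.+ 2) ℕ.* (2 ℕ.* e))
                 ℕ.+ (n ℕ.* n ℕ.+ 7 ℕ.* n ℕ.+ 24) ℕ.* e
               ≡ (suc n ℕ.* suc n ℕ.+ 11 ℕ.* suc n ℕ.+ 24) ℕ.* (2 ℕ.* e)
  step = solve-∀

count-start-0110 : ∀ n → 8 ℕ.* count start-0110 (suc n) ≡ startCount n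
count-start-0110 zero    = refl
count-start-0110 (suc n) = count-step₂ 8 start-0110 (suc n) refl
  (count-start-0110 n) (count-high-0110 0 n) (startCount-step n)

count-high-0100 : ∀ k n → 8 ℕ.* count (high-0100 k) (suc n) ≡ highCount n
count-high-0100 k zero    = refl
count-high-0100 k (suc n) = count-step₃ 8 (high-0100 k) (suc n) refl
  (quadruple (count (low-0100 k) (suc n)) low) (count-high-0100 k n) (count-high-0100 (suc k) n)
  (step n (2 ℕ.^ n))
  where
  low : 2 ℕ.* count (low-0100 k) (suc n) ≡ (n ℕ.+ 2) ℕ.* 2 ℕ.^ n ℕ.+ 2 ℕ.* 2 ℕ.^ n
  low = count-step₂ 2 (low-0100 k) n refl
    (count-zeroless₂ k n) (cong (2 ℕ.*_) (count-zeroless₁ (suc k) n)) refl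
  step : ∀ n e → 4 ℕ.* ((n ℕ.+ 2) ℕ.* e ℕ.+ 2 ℕ.* e) ℕ.+ (n ℕ.* n ℕ.+ 7 ℕ.* n ℕ.+ 24) ℕ.* e
                 ℕ.+ (n ℕ.* n ℕ.+ 7 ℕ.* n ℕ.+ 24) ℕ.* e
               ≡ (suc n ℕ.* suc n ℕ.+ 7 ℕ.* suc n ℕ.+ 24) ℕ.* (2 ℕ.* e)
  step = solve-∀

count-start-0100 : ∀ n → 8 ℕ.* count start-0100 (suc n) ≡ startCount n
count-start-0100 zero    = refl
count-start-0100 (suc n) = count-step₂ 8 start-0100 (suc n) refl
  (count-start-0100 n) (count-high-0100 0 n) (startCount-step n)

-- Same closed form as `zeroless₂`: the loop on 0 contributes as the loop on the maximum does there.
count-low-0010 : ∀ k n → 2 ℕ.* count (low-0010 k) n ≡ (n ℕ.+ 2) ℕ.* 2 ℕ.^ n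
count-low-0010 k zero    = refl
count-low-0010 k (suc n) = count-step₃ 2 (low-0010 k) n refl
  (count-low-0010 k n) (count-zeroless₂ k n) (cong (2 ℕ.*_) (count-zeroless₁ (suc k) n))
  (step n (2 ℕ.^ n))
  where
  step : ∀ n e → (n ℕ.+ 2) ℕ.* e ℕ.+ (n ℕ.+ 2) ℕ.* e ℕ.+ 2 ℕ.* e ≡ (suc n ℕ.+ 2) ℕ.* (2 ℕ.* e)
  step = solve-∀

count-high-0010 : ∀ k n → 8 ℕ.* count (high-0010 k) n ≡ (n ℕ.* n ℕ.+ 3 ℕ.* n ℕ.+ 8) ℕ.* 2 ℕ.^ n
count-high-0010 k zero    = refl
count-high-0010 k (suc n) = count-step₃ 8 (high-0010 k) n refl
  (quadruple (count (low-0010 k) n) (count-low-0010 k n))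
  (count-high-0010 k n) (count-high-0010 (suc k) n)
  (step n (2 ℕ.^ n))
  where
  step : ∀ n e → 4 ℕ.* ((n ℕ.+ 2) ℕ.* e) ℕ.+ (n ℕ.* n ℕ.+ 3 ℕ.* n ℕ.+ 8) ℕ.* e
                 ℕ.+ (n ℕ.* n ℕ.+ 3 ℕ.* n ℕ.+ 8) ℕ.* e
               ≡ (suc n ℕ.* suc n ℕ.+ 3 ℕ.* suc n ℕ.+ 8) ℕ.* (2 ℕ.* e)
  step = solve-∀

count-zeros-0010 : ∀ n → count zeros-0010 n ≡ 2 ℕ.^ n
count-zeros-0010 zero    = refl
count-zeros-0010 (suc n) = trans (count-suc zeros-0010 n)
  (cong₂ (λ x y → x ℕ.+ (y ℕ.+ 0)) (count-zeros-0010 n) (count-zeroless₁ 0 n))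

-- No induction: either first letter leaves the start state for good, since a 0 already forbids
-- every later nonzero entry followed by 0.
count-start-0010 : ∀ n → 8 ℕ.* count start-0010 (suc n) ≡ startCount n
count-start-0010 n = count-step₂ 8 start-0010 n refl
  (cong (8 ℕ.*_) (count-zeros-0010 n)) (count-high-0010 0 n) (step n (2 ℕ.^ n))
  where
  step : ∀ n e → 8 ℕ.* e ℕ.+ (n ℕ.* n ℕ.+ 3 ℕ.* n ℕ.+ 8) ℕ.* e ≡ (n ℕ.* n ℕ.+ 3 ℕ.* n ℕ.+ 16) ℕ.* e
  step = solve-∀

-- Exactly two letters, 0 and `suc k`, are allowed at every step, however many ascents there are.
count-high-max : ∀ a k n → count (high-max a k) n ≡ 2 ℕ.^ n
count-low-max  : ∀ a k n → count (low-max a k) n ≡ 2 ℕ.^ n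

count-high-max a k zero    = refl
count-high-max a k (suc n) = trans (count-suc (high-max a k) n)
  (cong₂ (λ x y → x ℕ.+ (y ℕ.+ 0)) (count-low-max a k n) (count-high-max a k n))

count-low-max a k zero    = refl
count-low-max a k (suc n) = trans (count-suc (low-max a k) n)
  (cong₂ (λ x y → x ℕ.+ (y ℕ.+ 0)) (count-low-max a k n) (count-high-max (suc a) k n))

sum-applyUpTo-const : ∀ {A : Set} (g : A → ℕ) f {c} m → (∀ i → g (f i) ≡ c) →
                      sum (map g (applyUpTo f m)) ≡ m ℕ.* c
sum-applyUpTo-const g f zero    eq = refl
sum-applyUpTo-const g f (suc m) eq = cong₂ ℕ._+_ (eq 0) (sum-applyUpTo-const g (f ∘ suc) m (eq ∘ suc))

-- Each of the `suc a` values available for the entry above 1 contributes 2ⁿ. High and low states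
-- differ only in h, the state reached by reading 1.
count-0123-suc : ∀ s h a n {p q} →
  next s ≡ (0 , low-0123 (suc a)) ∷ (1 , h) ∷ maxima-0123 (suc a) →
  8 ℕ.* count (low-0123 (suc a)) n ≡ p → 8 ℕ.* count h n ≡ q →
  8 ℕ.* count s (suc n) ≡ p ℕ.+ (q ℕ.+ 8 ℕ.* (suc a ℕ.* 2 ℕ.^ n))
count-0123-suc s h a n {p} {q} eq low high = begin
  8 ℕ.* count s (suc n)
    ≡⟨ cong (8 ℕ.*_) (count-suc s n) ⟩
  8 ℕ.* sum (map counts (next s))
    ≡⟨ cong (λ ts → 8 ℕ.* sum (map counts ts)) eq ⟩
  8 ℕ.* (l ℕ.+ (m ℕ.+ sum (map counts (maxima-0123 (suc a)))))
    ≡⟨ cong (λ z → 8 ℕ.* (l ℕ.+ (m ℕ.+ z)))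
         (sum-applyUpTo-const counts (λ i → 2 ℕ.+ i , high-max (2 ℕ.+ a) (suc i)) (suc a)
           (λ i → count-high-max (2 ℕ.+ a) (suc i) n)) ⟩
  8 ℕ.* (l ℕ.+ (m ℕ.+ suc a ℕ.* 2 ℕ.^ n))
    ≡⟨ distrib l m (suc a ℕ.* 2 ℕ.^ n) ⟩
  8 ℕ.* l ℕ.+ (8 ℕ.* m ℕ.+ 8 ℕ.* (suc a ℕ.* 2 ℕ.^ n))
    ≡⟨ cong₂ (λ x y → x ℕ.+ (y ℕ.+ 8 ℕ.* (suc a ℕ.* 2 ℕ.^ n))) low high ⟩
  p ℕ.+ (q ℕ.+ 8 ℕ.* (suc a ℕ.* 2 ℕ.^ n)) ∎
  where
  open ≡-Reasoning
  counts : ℕ × State → ℕ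
  counts (_ , t) = count t n
  l = count (low-0123 (suc a)) n
  m = count h n
  distrib : ∀ x y z → 8 ℕ.* (x ℕ.+ (y ℕ.+ z)) ≡ 8 ℕ.* x ℕ.+ (8 ℕ.* y ℕ.+ 8 ℕ.* z)
  distrib = solve-∀

-- Each extra initial ascent makes one more value available above 1. It can first appear at any of
-- the n + 1 places, with two choices for each of the other n letters; hence the correction a (n +
-- 1) 2ⁿ. A low state raises a when 1 is read, so the induction must range over all a.
count-high-0123 : ∀ a n → 8 ℕ.* count (high-0123 (suc a)) (suc n)
                        ≡ highCount n ℕ.+ 8 ℕ.* a ℕ.* suc n ℕ.* 2 ℕ.^ n
count-low-0123  : ∀ a n → 8 ℕ.* count (low-0123 (suc a)) (suc n)
                        ≡ lowCount n ℕ.+ 8 ℕ.* a ℕ.* suc n ℕ.* 2 ℕ.^ n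

count-high-0123 a zero    = trans (count-0123-suc (high-0123 (suc a)) _ a 0 refl refl refl) (base a)
  where
  base : ∀ a → 8 ℕ.+ (8 ℕ.+ 8 ℕ.* (suc a ℕ.* 1)) ≡ 24 ℕ.+ 8 ℕ.* a ℕ.* 1 ℕ.* 1
  base = solve-∀
count-high-0123 a (suc n) = trans
  (count-0123-suc (high-0123 (suc a)) _ a (suc n) refl (count-low-0123 a n) (count-high-0123 a n))
  (step a n (2 ℕ.^ n))
  where
  step : ∀ a n e → (n ℕ.* n ℕ.+ 11 ℕ.* n ℕ.+ 24) ℕ.* e ℕ.+ 8 ℕ.* a ℕ.* suc n ℕ.* e
                   ℕ.+ ((n ℕ.* n ℕ.+ 7 ℕ.* n ℕ.+ 24) ℕ.* e ℕ.+ 8 ℕ.* a ℕ.* suc n ℕ.* e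
                        ℕ.+ 8 ℕ.* (suc a ℕ.* (2 ℕ.* e)))
                 ≡ (suc n ℕ.* suc n ℕ.+ 7 ℕ.* suc n ℕ.+ 24) ℕ.* (2 ℕ.* e)
                   ℕ.+ 8 ℕ.* a ℕ.* suc (suc n) ℕ.* (2 ℕ.* e)
  step = solve-∀

count-low-0123 a zero    = trans (count-0123-suc (low-0123 (suc a)) _ a 0 refl refl refl) (base a)
  where
  base : ∀ a → 8 ℕ.+ (8 ℕ.+ 8 ℕ.* (suc a ℕ.* 1)) ≡ 24 ℕ.+ 8 ℕ.* a ℕ.* 1 ℕ.* 1
  base = solve-∀
count-low-0123 a (suc n) = trans
  (count-0123-suc (low-0123 (suc a)) _ a (suc n) refl (count-low-0123 a n) (count-high-0123 (suc a) n))
  (step a n (2 ℕ.^ n))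
  where
  step : ∀ a n e → (n ℕ.* n ℕ.+ 11 ℕ.* n ℕ.+ 24) ℕ.* e ℕ.+ 8 ℕ.* a ℕ.* suc n ℕ.* e
                   ℕ.+ ((n ℕ.* n ℕ.+ 7 ℕ.* n ℕ.+ 24) ℕ.* e ℕ.+ 8 ℕ.* suc a ℕ.* suc n ℕ.* e
                        ℕ.+ 8 ℕ.* (suc a ℕ.* (2 ℕ.* e)))
                 ≡ (suc n ℕ.* suc n ℕ.+ 11 ℕ.* suc n ℕ.+ 24) ℕ.* (2 ℕ.* e)
                   ℕ.+ 8 ℕ.* a ℕ.* suc (suc n) ℕ.* (2 ℕ.* e)
  step = solve-∀

count-start-0123 : ∀ n → 8 ℕ.* count start-0123 (suc n) ≡ startCount n
count-start-0123 zero    = refl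
count-start-0123 (suc n) = count-step₂ 8 start-0123 (suc n) refl
  (count-start-0123 n) (trans (count-high-0123 0 n) (ℕ.+-identityʳ _)) (startCount-step n)

-- The generating function

sum-zero : ∀ {n} (f : Fin n → ℤ) → (∀ i → f i ≡ 0ℤ) → ∑ f ≡ 0ℤ
sum-zero {zero}  f f≡0 = refl
sum-zero {suc n} f f≡0 = cong₂ ℤ._+_ (f≡0 zero) (sum-zero (f ∘ suc) (f≡0 ∘ suc))

-- For p of degree at most 1 the coefficient is p₀ hₙ₊₁ + p₁ hₙ. Numerator and denominator are built
-- by multiplying with such factors, so their degrees are bounded one factor at a time.
linear-*-zero : ∀ p h n → (∀ k → p (2 ℕ.+ k) ≡ 0ℤ) → h (suc n) ≡ 0ℤ → h n ≡ 0ℤ → (p * h) (suc n) ≡ 0ℤ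
linear-*-zero p h n p≡0 h≡0 h≡0′ = sum-zero {2 ℕ.+ n} (λ i → p (toℕ i) ℤ.* h (suc n ∸ toℕ i)) λ where
  zero          → trans (cong (p 0 ℤ.*_) h≡0) (ℤ.*-zeroʳ (p 0))
  (suc zero)    → trans (cong (p 1 ℤ.*_) h≡0′) (ℤ.*-zeroʳ (p 1))
  (suc (suc i)) → trans (cong (ℤ._* h (n ∸ suc (toℕ i))) (p≡0 (toℕ i)))
                        (ℤ.*-zeroˡ (h (n ∸ suc (toℕ i))))

numerator denominator : Series
numerator   = (1# - X) * (1# - 4 · X + 4 · X ^ 2 + X ^ 3)
denominator = (1# - 2 · X) ^ 3

denominator-degree : ∀ k → denominator (4 ℕ.+ k) ≡ 0ℤ
denominator-degree k =
  linear-*-zero p (p ^ 2) (3 ℕ.+ k) (λ _ → refl) (square (suc k)) (square k)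
  where
  p = 1# - 2 · X
  first : ∀ k → (p ^ 1) (2 ℕ.+ k) ≡ 0ℤ
  first k = linear-*-zero p 1# (1 ℕ.+ k) (λ _ → refl) refl refl
  square : ∀ k → (p ^ 2) (3 ℕ.+ k) ≡ 0ℤ
  square k = linear-*-zero p (p ^ 1) (2 ℕ.+ k) (λ _ → refl) (first (suc k)) (first k)

numerator-degree : ∀ k → numerator (5 ℕ.+ k) ≡ 0ℤ
numerator-degree k =
  linear-*-zero (1# - X) cubic (4 ℕ.+ k) (λ _ → refl) (cubic-degree (suc k)) (cubic-degree k)
  where
  cubic : Series
  cubic = 1# - 4 · X + 4 · X ^ 2 + X ^ 3
  first : ∀ k → (X ^ 1) (2 ℕ.+ k) ≡ 0ℤ
  first k = linear-*-zero X 1# (1 ℕ.+ k) (λ _ → refl) refl refl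
  square : ∀ k → (X ^ 2) (3 ℕ.+ k) ≡ 0ℤ
  square k = linear-*-zero X (X ^ 1) (2 ℕ.+ k) (λ _ → refl) (first (suc k)) (first k)
  cube : ∀ k → (X ^ 3) (4 ℕ.+ k) ≡ 0ℤ
  cube k = linear-*-zero X (X ^ 2) (3 ℕ.+ k) (λ _ → refl) (square (suc k)) (square k)
  cubic-degree : ∀ k → cubic (4 ℕ.+ k) ≡ 0ℤ
  cubic-degree k = cong₂ (λ s t → 0ℤ ℤ.+ + 4 ℤ.* s ℤ.+ t) (square (suc k)) (cube k)

-- (1 - 2x)³ = 1 - 6x + 12x² - 8x³, so a series q with this recurrence is the quotient of
-- q₀ + (q₁ - 6q₀)x + (q₂ - 6q₁ + 12q₀)x² by it; long division shifts q.
/-denominator : ∀ (f q : Series) →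
  (∀ n → q (3 ℕ.+ n) ≡ + 6 ℤ.* q (2 ℕ.+ n) ℤ.- + 12 ℤ.* q (1 ℕ.+ n) ℤ.+ + 8 ℤ.* q n) →
  f 0 ≡ q 0 → f 1 ≡ q 1 ℤ.- + 6 ℤ.* q 0 → f 2 ≡ q 2 ℤ.- + 6 ℤ.* q 1 ℤ.+ + 12 ℤ.* q 0 →
  (∀ k → f (3 ℕ.+ k) ≡ 0ℤ) → f / denominator ⟨ refl ⟩ ≈ q
/-denominator f q rec f₀ f₁ f₂ f₃ zero    = f₀
/-denominator f q rec f₀ f₁ f₂ f₃ (suc n) = /-denominator f′ (q ∘ suc) (rec ∘ suc)
  (trans (cong₂ (λ x y → x ℤ.- y ℤ.* denominator 1) f₁ f₀) (eq₀ (q 0) (q 1)))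
  (trans (cong₂ (λ x y → x ℤ.- y ℤ.* denominator 2) f₂ f₀) (eq₁ (q 0) (q 1) (q 2)))
  -- Here the shifted coefficient is 0 + 8q₀, and the recurrence at 0 rewrites it as q₃ - 6q₂ +
  -- 12q₁.
  (trans (cong₂ (λ x y → x ℤ.- y ℤ.* denominator 3) (f₃ 0) f₀)
    (trans (eq₂ (q 0) (q 1) (q 2))
      (cong (λ z → z ℤ.- + 6 ℤ.* q 2 ℤ.+ + 12 ℤ.* q 1) (sym (rec 0)))))
  (λ k → trans (cong₂ (λ x y → x ℤ.- f 0 ℤ.* y) (f₃ (suc k)) (denominator-degree k)) (eq₃ (f 0)))
  n
  where
  f′ : Series
  f′ m = f (suc m) ℤ.- f 0 ℤ.* denominator (suc m)
  eq₀ : ∀ a b → b ℤ.- + 6 ℤ.* a ℤ.- a ℤ.* -[1+ 5 ] ≡ b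
  eq₀ = ℤ.solve-∀
  eq₁ : ∀ a b c → c ℤ.- + 6 ℤ.* b ℤ.+ + 12 ℤ.* a ℤ.- a ℤ.* + 12 ≡ c ℤ.- + 6 ℤ.* b
  eq₁ = ℤ.solve-∀
  eq₂ : ∀ a b c → 0ℤ ℤ.- a ℤ.* -[1+ 7 ]
        ≡ + 6 ℤ.* c ℤ.- + 12 ℤ.* b ℤ.+ + 8 ℤ.* a ℤ.- + 6 ℤ.* c ℤ.+ + 12 ℤ.* b
  eq₂ = ℤ.solve-∀
  eq₃ : ∀ a → 0ℤ ℤ.- a ℤ.* 0ℤ ≡ 0ℤ
  eq₃ = ℤ.solve-∀

-- A quadratic polynomial times 2ⁿ satisfies the recurrence with triple root 2. The negative term is
-- moved to the left to stay in ℕ.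
startCount-rec : ∀ n → startCount (3 ℕ.+ n) ℕ.+ 12 ℕ.* startCount (1 ℕ.+ n)
                     ≡ 6 ℕ.* startCount (2 ℕ.+ n) ℕ.+ 8 ℕ.* startCount n
startCount-rec n = identity n (2 ℕ.^ n)
  where
  identity : ∀ n e →
    ((3 ℕ.+ n) ℕ.* (3 ℕ.+ n) ℕ.+ 3 ℕ.* (3 ℕ.+ n) ℕ.+ 16) ℕ.* (2 ℕ.* (2 ℕ.* (2 ℕ.* e)))
      ℕ.+ 12 ℕ.* (((1 ℕ.+ n) ℕ.* (1 ℕ.+ n) ℕ.+ 3 ℕ.* (1 ℕ.+ n) ℕ.+ 16) ℕ.* (2 ℕ.* e))
    ≡ 6 ℕ.* (((2 ℕ.+ n) ℕ.* (2 ℕ.+ n) ℕ.+ 3 ℕ.* (2 ℕ.+ n) ℕ.+ 16) ℕ.* (2 ℕ.* (2 ℕ.* e)))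
      ℕ.+ 8 ℕ.* ((n ℕ.* n ℕ.+ 3 ℕ.* n ℕ.+ 16) ℕ.* e)
  identity = solve-∀

-- The closed form starts at index 2. Two steps of long division split off the coefficients 1 and 1
-- and bring the dividend from degree 4 down to degree 2, where `/-denominator` applies.
quotient : ∀ (c : ℕ → ℕ) → c 0 ≡ 1 → c 1 ≡ 1 → (∀ n → 8 ℕ.* c (2 ℕ.+ n) ≡ startCount n) →
           (λ n → + c n) ≈ numerator / denominator ⟨ refl ⟩
quotient c c₀ c₁ closed zero          = cong +_ c₀
quotient c c₀ c₁ closed (suc zero)    = cong +_ c₁
quotient c c₀ c₁ closed (suc (suc n)) = sym (/-denominator f″ q rec
  -- The dividend `f″` has coefficients 2, -7, 7, which are 2, 5 - 6·2 and 13 - 6·5 + 12·2 for the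
  -- values 2, 5, 13 of c at 2, 3, 4.
  (cong +_ (sym q₀)) (cong₂ (λ x y → + x ℤ.- + 6 ℤ.* + y) (sym q₁) (sym q₀))
  (trans (cong₂ (λ x y → + x ℤ.- + 6 ℤ.* + y ℤ.+ + 24) (sym q₂) (sym q₁))
         (cong (λ x → q 2 ℤ.- + 6 ℤ.* q 1 ℤ.+ + 12 ℤ.* + x) (sym q₀)))
  (λ k → cong₂ (λ x y → x ℤ.- 1ℤ ℤ.* y)
    (cong₂ (λ x y → x ℤ.- 1ℤ ℤ.* y) (numerator-degree k) (denominator-degree (suc k)))
    (denominator-degree k))
  n)
  where
  f′ f″ : Series
  f′ m = numerator (suc m) ℤ.- numerator 0 ℤ.* denominator (suc m)
  f″ m = f′ (suc m) ℤ.- f′ 0 ℤ.* denominator (suc m)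
  q : Series
  q n = + c (2 ℕ.+ n)
  q₀ : c 2 ≡ 2
  q₀ = ℕ.*-cancelˡ-≡ _ _ 8 (closed 0)
  q₁ : c 3 ≡ 5
  q₁ = ℕ.*-cancelˡ-≡ _ _ 8 (closed 1)
  q₂ : c 4 ≡ 13
  q₂ = ℕ.*-cancelˡ-≡ _ _ 8 (closed 2)
  recℕ : ∀ n → c (5 ℕ.+ n) ℕ.+ 12 ℕ.* c (3 ℕ.+ n) ≡ 6 ℕ.* c (4 ℕ.+ n) ℕ.+ 8 ℕ.* c (2 ℕ.+ n)
  recℕ n = ℕ.*-cancelˡ-≡ _ _ 8 (begin
    8 ℕ.* (c (5 ℕ.+ n) ℕ.+ 12 ℕ.* c (3 ℕ.+ n))
      ≡⟨ distribˡ (c (5 ℕ.+ n)) (c (3 ℕ.+ n)) ⟩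
    8 ℕ.* c (5 ℕ.+ n) ℕ.+ 12 ℕ.* (8 ℕ.* c (3 ℕ.+ n))
      ≡⟨ cong₂ (λ x y → x ℕ.+ 12 ℕ.* y) (closed (3 ℕ.+ n)) (closed (1 ℕ.+ n)) ⟩
    startCount (3 ℕ.+ n) ℕ.+ 12 ℕ.* startCount (1 ℕ.+ n)
      ≡⟨ startCount-rec n ⟩
    6 ℕ.* startCount (2 ℕ.+ n) ℕ.+ 8 ℕ.* startCount n
      ≡⟨ cong₂ (λ x y → 6 ℕ.* x ℕ.+ 8 ℕ.* y) (closed (2 ℕ.+ n)) (closed n) ⟨
    6 ℕ.* (8 ℕ.* c (4 ℕ.+ n)) ℕ.+ 8 ℕ.* (8 ℕ.* c (2 ℕ.+ n))
      ≡⟨ distribʳ (c (4 ℕ.+ n)) (c (2 ℕ.+ n)) ⟨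
    8 ℕ.* (6 ℕ.* c (4 ℕ.+ n) ℕ.+ 8 ℕ.* c (2 ℕ.+ n)) ∎)
    where
    open ≡-Reasoning
    distribˡ : ∀ x y → 8 ℕ.* (x ℕ.+ 12 ℕ.* y) ≡ 8 ℕ.* x ℕ.+ 12 ℕ.* (8 ℕ.* y)
    distribˡ = solve-∀
    distribʳ : ∀ x y → 8 ℕ.* (6 ℕ.* x ℕ.+ 8 ℕ.* y) ≡ 6 ℕ.* (8 ℕ.* x) ℕ.+ 8 ℕ.* (8 ℕ.* y)
    distribʳ = solve-∀
  rec : ∀ n → q (3 ℕ.+ n) ≡ + 6 ℤ.* q (2 ℕ.+ n) ℤ.- + 12 ℤ.* q (1 ℕ.+ n) ℤ.+ + 8 ℤ.* q n
  rec n = begin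
    q (3 ℕ.+ n)
      ≡⟨ add-sub (q (3 ℕ.+ n)) (+ 12 ℤ.* q (1 ℕ.+ n)) ⟩
    q (3 ℕ.+ n) ℤ.+ + 12 ℤ.* q (1 ℕ.+ n) ℤ.- + 12 ℤ.* q (1 ℕ.+ n)
      ≡⟨ cong (λ z → q (3 ℕ.+ n) ℤ.+ z ℤ.- + 12 ℤ.* q (1 ℕ.+ n)) (ℤ.pos-* 12 (c (3 ℕ.+ n))) ⟨
    + (c (5 ℕ.+ n) ℕ.+ 12 ℕ.* c (3 ℕ.+ n)) ℤ.- + 12 ℤ.* q (1 ℕ.+ n)
      ≡⟨ cong (λ z → + z ℤ.- + 12 ℤ.* q (1 ℕ.+ n)) (recℕ n) ⟩
    + (6 ℕ.* c (4 ℕ.+ n)) ℤ.+ + (8 ℕ.* c (2 ℕ.+ n)) ℤ.- + 12 ℤ.* q (1 ℕ.+ n)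
      ≡⟨ cong₂ (λ y z → y ℤ.+ z ℤ.- + 12 ℤ.* q (1 ℕ.+ n))
           (ℤ.pos-* 6 (c (4 ℕ.+ n))) (ℤ.pos-* 8 (c (2 ℕ.+ n))) ⟩
    + 6 ℤ.* q (2 ℕ.+ n) ℤ.+ + 8 ℤ.* q n ℤ.- + 12 ℤ.* q (1 ℕ.+ n)
      ≡⟨ swap (+ 6 ℤ.* q (2 ℕ.+ n)) (+ 8 ℤ.* q n) (+ 12 ℤ.* q (1 ℕ.+ n)) ⟩
    + 6 ℤ.* q (2 ℕ.+ n) ℤ.- + 12 ℤ.* q (1 ℕ.+ n) ℤ.+ + 8 ℤ.* q n ∎
    where
    open ≡-Reasoning
    add-sub : ∀ x y → x ≡ x ℤ.+ y ℤ.- y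
    add-sub = ℤ.solve-∀
    swap : ∀ x y z → x ℤ.+ y ℤ.- z ≡ x ℤ.- z ℤ.+ y
    swap = ℤ.solve-∀

theorem2p1 : (τ : List ℕ) →
    τ ∈ ( (0 ∷ 0 ∷ 1 ∷ 0 ∷ []) ∷ (0 ∷ 1 ∷ 0 ∷ 0 ∷ [])
    ∷ (0 ∷ 1 ∷ 1 ∷ 0 ∷ []) ∷ (0 ∷ 1 ∷ 2 ∷ 3 ∷ []) ∷ []) →
    generatingFunction τ ≈
    (1# - X) * (1# - 4 · X + 4 · X ^ 2 + X ^ 3) / (1# - 2 · X) ^ 3 ⟨ refl ⟩
theorem2p1 τ (here refl) = quotient (b τ) refl (counted 0)
  (λ n → trans (cong (8 ℕ.*_) (counted (suc n))) (count-start-0010 n))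
  where
  counted : ∀ n → b τ (suc n) ≡ count start-0010 n
  counted = b-count (NoScaled (0 ∷ 1 ∷ 0 ∷ [])) start-0010 (noScaled (0 ∷ 1 ∷ 0 ∷ [])) avoids-0010⁺ refl
theorem2p1 τ (there (here refl)) = quotient (b τ) refl (counted 0)
  (λ n → trans (cong (8 ℕ.*_) (counted (suc n))) (count-start-0100 n))
  where
  counted : ∀ n → b τ (suc n) ≡ count start-0100 n
  counted = b-count (NoScaled (1 ∷ 0 ∷ 0 ∷ [])) start-0100 (noScaled (1 ∷ 0 ∷ 0 ∷ [])) avoids-0100⁺ refl
theorem2p1 τ (there (there (here refl))) = quotient (b τ) refl (counted 0)
  (λ n → trans (cong (8 ℕ.*_) (counted (suc n))) (count-start-0110 n))
  where
  counted : ∀ n → b τ (suc n) ≡ count start-0110 n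
  counted = b-count (NoScaled (1 ∷ 1 ∷ 0 ∷ [])) start-0110 (noScaled (1 ∷ 1 ∷ 0 ∷ [])) avoids-0110⁺ refl
theorem2p1 τ (there (there (there (here refl)))) = quotient (b τ) refl (counted 0)
  (λ n → trans (cong (8 ℕ.*_) (counted (suc n))) (count-start-0123 n))
  where
  counted : ∀ n → b τ (suc n) ≡ count start-0123 n
  counted = b-count No123 start-0123 no123 (λ _ → avoids-0123⁺) refl
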